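{- Let $k\in\mathbb{N}$, and let the infinite symmetric group $S_\infty$ act diagonally on the Banach space $\ell^\infty(\mathbb{N}^k)$ of bounded complex functions on $\mathbb{N}^k$. Then the vector space $(\ell^\infty(\mathbb{N}^k))^{S_\infty}$ of $S_\infty$-invariant elements of $\ell^\infty(\mathbb{N}^k)$ has the functions $\{m_\pi\mid \pi\text{ a set partition of }\{1,\dots,k\}\}$ as a basis. Moreover, the centralizer of $\mathbb{C}S_\infty$ in $\mathcal{B}_{\mathrm{Mat}}(\ell^\infty(\mathbb{N}^k))$, that is, the algebra of all $A\in\mathcal{B}_{\mathrm{Mat}}(\ell^\infty(\mathbb{N}^k))$ with $\sigma A=A\sigma$ for all $\sigma\in S_\infty$, is isomorphic as a $\mathbb{C}$-algebra to the finite-dimensional bottom-propagating partition algebra $BP_k$.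
   Context: $\mathbb{N}=\{1,2,\dots\}$. $S_\infty$ is the group of permutations of $\mathbb{N}$ that fix all but finitely many elements. For $\mathbf{i}=(i_1,\dots,i_k)\in\mathbb{N}^k$ and $\sigma\in S_\infty$, $\sigma(\mathbf{i})=(\sigma(i_1),\dots,\sigma(i_k))$. $\ell^\infty(\mathbb{N}^k)=\{v=(a_{\mathbf{i}})_{\mathbf{i}\in\mathbb{N}^k}\in\mathbb{C}^{\mathbb{N}^k}\mid \|v\|_\infty=\sup_{\mathbf{i}}|a_{\mathbf{i}}|<\infty\}$. The group $S_\infty$ acts by $\sigma\cdot(a_{\mathbf{i}})_{\mathbf{i}}=(a_{\sigma^{ -1}(\mathbf{i})})_{\mathbf{i}}$, so that $\sigma\cdot v_{\mathbf{i}}=v_{\sigma(\mathbf{i})}$, where $v_{\mathbf{i}}$ is the indicator function of $\mathbf{i}$. For a set partition $\pi$ of $\{1,\dots,k\}$, $m_\pi\in\mathbb{C}^{\mathbb{N}^k}$ is the function $\mathbf{i}\mapsto\pi_{\mathbf{i}}$, where $\pi_{(i_1,\dots,i_k)}=1$ if $i_\ell=i_m$ whenever $\ell$ and $m$ are in the same block of $\pi$, and $\pi_{(i_1,\dots,i_k)}=0$ otherwise. $\mathcal{B}_{\mathrm{Mat}}(\ell^\infty(\mathbb{N}^k))$ is the set of matrices $A=(A_{\mathbf{i}}^{\mathbf{j}})_{\mathbf{i},\mathbf{j}\in\mathbb{N}^k}$ with complex entries such that $$\|A\|_{\mathrm{Mat}}=\sup_{\mathbf{j}\in\mathbb{N}^k}\sum_{\mathbf{i}\in\mathbb{N}^k}|A_{\mathbf{i}}^{\mathbf{j}}|<\infty.$$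 Such an $A$ acts on $v=(b_{\mathbf{i}})_{\mathbf{i}}\in\ell^\infty(\mathbb{N}^k)$ by $(A(v))_{\mathbf{j}}=\sum_{\mathbf{i}}A_{\mathbf{i}}^{\mathbf{j}}b_{\mathbf{i}}$ (absolutely convergent), and this makes $\mathcal{B}_{\mathrm{Mat}}(\ell^\infty(\mathbb{N}^k))$ a subalgebra of the algebra of bounded operators on $\ell^\infty(\mathbb{N}^k)$, with composition given by $(AB)_{\mathbf{i}}^{\mathbf{l}}=\sum_{\mathbf{j}}A_{\mathbf{j}}^{\mathbf{l}}B_{\mathbf{i}}^{\mathbf{j}}$. Each $\sigma\in S_\infty$ acts on $\ell^\infty(\mathbb{N}^k)$ as an element of this algebra. Diagrams. Let $[k]=\{1,\dots,k\}$ and $[k']=\{1',\dots,k'\}$, with $[k]\cup[k']$ a set of $2k$ elements. A $k$-diagram is a set partition of $[k]\cup[k']$, drawn as a graph (up to having the same connected components, which are the blocks) with top row of vertices $1,\dots,k$ and bottom row $1',\dots,k'$. The concatenation product $d_1*d_2$ of diagrams $d_1,d_2$ is obtained by placing $d_1$ on top of $d_2$, identifying the bottom vertex $\ell'$ of $d_1$ with the top vertex $\ell$ of $d_2$ for each $\ell$, taking connected components, and restricting them to the top vertices of $d_1$ and the bottom vertices of $d_2$. (In the general partition algebra a factor $x^m$ is included, where $m$ is the number of components consisting only of middle vertices; for the diagrams spanning $BP_k$ always $m=0$, so no parameter is involved.) $BP_k$ is the $\mathbb{C}$-algebra with basis the $k$-diagrams $d$ having no block isolated to the bottom row (i.e.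 no block $B$ of $d$ satisfies $B\subseteq[k']$), with multiplication the bilinear extension of the concatenation product $d_1*d_2$ of diagrams; its identity is the diagram $\{\{1,1'\},\dots,\{k,k'\}\}$. -}

module Defs where

open import Data.Bool using (Bool; true; false; T; if_then_else_)
open import Data.Bool.Properties using (T?) renaming (_≟_ to _≟ᵇ_)
open import Data.Empty using (⊥; ⊥-elim)
open import Data.Fin using (Fin)
open import Data.Fin.Properties using (all?) renaming (_≟_ to _≟ᶠ_)
open import Data.Integer as ℤ using (ℤ; +_)
import Data.Integer.Properties as ℤ
open import Data.List using (List; []; _∷_; _++_; map; foldr; filter; allFin; cartesianProduct; cartesianProductWith; concatMap)
open import Data.List.Membership.Propositional using (_∈_; _∉_)
open import Data.List.Membership.Propositional.Properties using (∈-map⁺; ∈-map⁻; ∈-++⁺ˡ; ∈-++⁺ʳ; ∈-++⁻; ∈-filter⁺; ∈-filter⁻; ∈-cartesianProduct⁺; ∈-allFin)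
open import Data.List.Relation.Binary.Subset.Propositional using (_⊆_)
open import Data.List.Relation.Unary.Any using (here; there)
open import Data.List.Relation.Unary.Unique.Propositional using (Unique)
open import Data.Nat as ℕ using (ℕ; zero; suc)
import Data.Nat.DivMod as ℕ
import Data.Nat.Properties as ℕ
open import Data.Product using (∃; ∃-syntax; _×_; _,_; proj₂)
open import Data.Rational as ℚ using (ℚ; 0ℚ; 1ℚ; ½; mkℚ; ↥_; ↧ₙ_; toℚᵘ)
import Data.Rational.Properties as ℚ
open import Data.Rational.Solver using (module +-*-Solver)
import Data.Rational.Unnormalised as ℚᵘ
import Data.Rational.Unnormalised.Properties as ℚᵘ
open import Data.Sum using (_⊎_; inj₁; inj₂)
open import Data.Unit using (⊤; tt)
open import Data.Vec as Vec using (Vec; lookup)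
import Data.Vec.Properties as Vec
open import Function using (_∘_; _↔_; Inverse)
open import Level using (0ℓ)
open import Relation.Binary using (Rel; Decidable; DecidableEquality; IsEquivalence; DecSetoid)
import Relation.Binary.Construct.On as On
open import Relation.Binary.Construct.Closure.Equivalence as Eq using (EqClosure)
open import Relation.Binary.Construct.Closure.ReflexiveTransitive using (_◅_; _◅◅_) renaming (ε to stop)
open import Relation.Binary.Construct.Closure.Symmetric using (fwd; bwd)
open import Relation.Binary.PropositionalEquality using (_≡_; refl; sym; trans; cong; cong₂; subst; subst₂)
open import Relation.Nullary using (¬_; Dec; yes; no; does)
open import Relation.Nullary.Decidable using (map′; _×-dec_; _⊎-dec_; _→-dec_)

------------------------------------------------------------------------
-- Real numbers: Cauchy sequences of rationals, compared by the setoid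
-- equality _≈ℝ_.

IsCauchy : (ℕ → ℚ) → Set
IsCauchy x = ∀ ε → 0ℚ ℚ.< ε →
  ∃[ N ] ∀ m n → N ℕ.≤ m → N ℕ.≤ n → ℚ.∣ x m ℚ.- x n ∣ ℚ.< ε

record ℝ : Set where
  constructor mkℝ
  field
    seq    : ℕ → ℚ
    cauchy : IsCauchy seq

open ℝ public

infix 4 _≈ℝ_ _≤ℝ_

_≈ℝ_ : Rel ℝ 0ℓ
x ≈ℝ y = ∀ ε → 0ℚ ℚ.< ε →
  ∃[ N ] ∀ n → N ℕ.≤ n → ℚ.∣ seq x n ℚ.- seq y n ∣ ℚ.< ε

_≤ℝ_ : Rel ℝ 0ℓ
x ≤ℝ y = ∀ ε → 0ℚ ℚ.< ε →
  ∃[ N ] ∀ n → N ℕ.≤ n → seq x n ℚ.≤ seq y n ℚ.+ ε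

open +-*-Solver using (solve; _:=_; _:+_; _:*_; _:-_; :-_; con)

half-pos : ∀ {ε} → 0ℚ ℚ.< ε → 0ℚ ℚ.< ½ ℚ.* ε
half-pos {ε} 0<ε = subst (ℚ._< ½ ℚ.* ε) (ℚ.*-zeroʳ ½) (ℚ.*-monoʳ-<-pos ½ 0<ε)

half+half : ∀ ε → ½ ℚ.* ε ℚ.+ ½ ℚ.* ε ≡ ε
half+half = solve 1 (λ e → con ½ :* e :+ con ½ :* e := e) refl

∣-∣-sym : ∀ p q → ℚ.∣ p ℚ.- q ∣ ≡ ℚ.∣ q ℚ.- p ∣
∣-∣-sym p q = trans (sym (ℚ.∣-p∣≡∣p∣ (p ℚ.- q)))
  (cong ℚ.∣_∣ (solve 2 (λ p q → :- (p :- q) := q :- p) refl p q))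

p≤∣p∣ : ∀ p → p ℚ.≤ ℚ.∣ p ∣
p≤∣p∣ p with ℚ.≤-total 0ℚ p
... | inj₁ 0≤p = ℚ.≤-reflexive (sym (ℚ.0≤p⇒∣p∣≡p 0≤p))
... | inj₂ p≤0 = ℚ.≤-trans p≤0 (ℚ.0≤∣p∣ p)

∣p∣<ε : ∀ {p ε} → p ℚ.< ε → ℚ.- p ℚ.< ε → ℚ.∣ p ∣ ℚ.< ε
∣p∣<ε {p} {ε} p<ε -p<ε with ℚ.∣p∣≡p∨∣p∣≡-p p
... | inj₁ eq = subst (ℚ._< ε) (sym eq) p<ε
... | inj₂ eq = subst (ℚ._< ε) (sym eq) -p<ε

∣∣-diff : ∀ p q → ℚ.∣ p ∣ ℚ.- ℚ.∣ q ∣ ℚ.≤ ℚ.∣ p ℚ.- q ∣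
∣∣-diff p q = begin
  ℚ.∣ p ∣ ℚ.- ℚ.∣ q ∣                      ≡⟨ cong (λ r → ℚ.∣ r ∣ ℚ.- ℚ.∣ q ∣) (solve 2 (λ p q → p := (p :- q) :+ q) refl p q) ⟩
  ℚ.∣ (p ℚ.- q) ℚ.+ q ∣ ℚ.- ℚ.∣ q ∣        ≤⟨ ℚ.+-monoˡ-≤ (ℚ.- ℚ.∣ q ∣) (ℚ.∣p+q∣≤∣p∣+∣q∣ (p ℚ.- q) q) ⟩
  ℚ.∣ p ℚ.- q ∣ ℚ.+ ℚ.∣ q ∣ ℚ.- ℚ.∣ q ∣    ≡⟨ solve 2 (λ a b → (a :+ b) :- b := a) refl ℚ.∣ p ℚ.- q ∣ ℚ.∣ q ∣ ⟩
  ℚ.∣ p ℚ.- q ∣                            ∎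
  where open ℚ.≤-Reasoning

*-mono : ∀ {a b c d} → 0ℚ ℚ.≤ a → 0ℚ ℚ.≤ d → a ℚ.≤ b → c ℚ.≤ d → a ℚ.* c ℚ.≤ b ℚ.* d
*-mono {a} {b} {c} {d} 0≤a 0≤d a≤b c≤d = ℚ.≤-trans
  (ℚ.*-monoˡ-≤-nonNeg a {{ℚ.nonNegative 0≤a}} c≤d)
  (ℚ.*-monoʳ-≤-nonNeg d {{ℚ.nonNegative 0≤d}} a≤b)

small : ∀ B {ε} → 0ℚ ℚ.≤ B → 0ℚ ℚ.< ε → ∃[ δ ] 0ℚ ℚ.< δ × B ℚ.* δ ℚ.< ε
small B {ε} 0≤B 0<ε = δ , 0<δ , (begin-strict
    B ℚ.* δ          <⟨ ℚ.*-monoˡ-<-pos δ {{ℚ.positive 0<δ}} B<B+1 ⟩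
    (B ℚ.+ 1ℚ) ℚ.* δ ≡⟨ sym (ℚ.*-assoc (B ℚ.+ 1ℚ) r ε) ⟩
    (B ℚ.+ 1ℚ) ℚ.* r ℚ.* ε ≡⟨ cong (ℚ._* ε) (ℚ.*-inverseʳ (B ℚ.+ 1ℚ)) ⟩
    1ℚ ℚ.* ε         ≡⟨ ℚ.*-identityˡ ε ⟩
    ε                ∎)
  where
  open ℚ.≤-Reasoning
  B<B+1 : B ℚ.< B ℚ.+ 1ℚ
  B<B+1 = subst (ℚ._< B ℚ.+ 1ℚ) (ℚ.+-identityʳ B) (ℚ.+-monoʳ-< B (ℚ.positive⁻¹ 1ℚ))
  instance
    B+1-pos : ℚ.Positive (B ℚ.+ 1ℚ)
    B+1-pos = ℚ.positive (ℚ.≤-<-trans 0≤B B<B+1)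
    B+1-nz : ℚ.NonZero (B ℚ.+ 1ℚ)
    B+1-nz = ℚ.pos⇒nonZero (B ℚ.+ 1ℚ)
  r δ : ℚ
  r = ℚ.1/ (B ℚ.+ 1ℚ)
  δ = r ℚ.* ε
  0<δ : 0ℚ ℚ.< δ
  0<δ = ℚ.positive⁻¹ δ {{ℚ.pos*pos⇒pos r {{ℚ.1/pos⇒pos (B ℚ.+ 1ℚ)}} ε {{ℚ.positive 0<ε}}}}

eventually-bounded : ∀ {x} → IsCauchy x →
  ∃[ B ] ∃[ N ] 0ℚ ℚ.≤ B × (∀ n → N ℕ.≤ n → ℚ.∣ x n ∣ ℚ.≤ B)
eventually-bounded {x} cx with cx 1ℚ (ℚ.positive⁻¹ 1ℚ)
... | N , close = ℚ.∣ x N ∣ ℚ.+ 1ℚ , N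
    , ℚ.≤-trans (ℚ.0≤∣p∣ (x N)) (ℚ.≤-trans (ℚ.≤-reflexive (sym (ℚ.+-identityʳ ℚ.∣ x N ∣)))
        (ℚ.+-monoʳ-≤ ℚ.∣ x N ∣ (ℚ.<⇒≤ (ℚ.positive⁻¹ 1ℚ))))
    , λ n N≤n → begin
        ℚ.∣ x n ∣                         ≡⟨ solve 2 (λ a b → a := b :+ (a :- b)) refl ℚ.∣ x n ∣ ℚ.∣ x N ∣ ⟩
        ℚ.∣ x N ∣ ℚ.+ (ℚ.∣ x n ∣ ℚ.- ℚ.∣ x N ∣) ≤⟨ ℚ.+-monoʳ-≤ ℚ.∣ x N ∣ (∣∣-diff (x n) (x N)) ⟩
        ℚ.∣ x N ∣ ℚ.+ ℚ.∣ x n ℚ.- x N ∣   ≤⟨ ℚ.+-monoʳ-≤ ℚ.∣ x N ∣ (ℚ.<⇒≤ (close n N N≤n ℕ.≤-refl)) ⟩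
        ℚ.∣ x N ∣ ℚ.+ 1ℚ                  ∎
  where open ℚ.≤-Reasoning

opaque
  cauchy-const : ∀ q → IsCauchy (λ _ → q)
  cauchy-const q ε 0<ε = 0 , λ _ _ _ _ →
    subst (λ r → ℚ.∣ r ∣ ℚ.< ε) (sym (ℚ.+-inverseʳ q)) 0<ε

  cauchy-+ : ∀ {x y} → IsCauchy x → IsCauchy y → IsCauchy (λ n → x n ℚ.+ y n)
  cauchy-+ {x} {y} cx cy ε 0<ε with cx (½ ℚ.* ε) (half-pos 0<ε) | cy (½ ℚ.* ε) (half-pos 0<ε)
  ... | M , cx′ | N , cy′ = M ℕ.⊔ N , λ m n p q → begin-strict
      ℚ.∣ (x m ℚ.+ y m) ℚ.- (x n ℚ.+ y n) ∣ ≡⟨ cong ℚ.∣_∣ (solve 4 (λ a b c d → (a :+ b) :- (c :+ d) := (a :- c) :+ (b :- d)) refl (x m) (y m) (x n) (y n)) ⟩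
      ℚ.∣ (x m ℚ.- x n) ℚ.+ (y m ℚ.- y n) ∣ ≤⟨ ℚ.∣p+q∣≤∣p∣+∣q∣ (x m ℚ.- x n) (y m ℚ.- y n) ⟩
      ℚ.∣ x m ℚ.- x n ∣ ℚ.+ ℚ.∣ y m ℚ.- y n ∣ <⟨ ℚ.+-mono-<
          (cx′ m n (ℕ.m⊔n≤o⇒m≤o M N p) (ℕ.m⊔n≤o⇒m≤o M N q))
          (cy′ m n (ℕ.m⊔n≤o⇒n≤o M N p) (ℕ.m⊔n≤o⇒n≤o M N q)) ⟩
      ½ ℚ.* ε ℚ.+ ½ ℚ.* ε ≡⟨ half+half ε ⟩
      ε ∎
    where open ℚ.≤-Reasoning

  cauchy-neg : ∀ {x} → IsCauchy x → IsCauchy (λ n → ℚ.- x n)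
  cauchy-neg {x} cx ε 0<ε with cx ε 0<ε
  ... | N , cx′ = N , λ m n p q → subst (ℚ._< ε)
    (trans (∣-∣-sym (x m) (x n)) (cong ℚ.∣_∣ (solve 2 (λ a b → b :- a := (:- a) :- (:- b)) refl (x m) (x n))))
    (cx′ m n p q)

  cauchy-abs : ∀ {x} → IsCauchy x → IsCauchy (λ n → ℚ.∣ x n ∣)
  cauchy-abs {x} cx ε 0<ε with cx ε 0<ε
  ... | N , cx′ = N , λ m n p q → ∣p∣<ε
    (ℚ.≤-<-trans (∣∣-diff (x m) (x n)) (cx′ m n p q))
    (ℚ.≤-<-trans (ℚ.≤-reflexive (solve 2 (λ a b → :- (a :- b) := b :- a) refl ℚ.∣ x m ∣ ℚ.∣ x n ∣))
      (ℚ.≤-<-trans (∣∣-diff (x n) (x m)) (cx′ n m q p)))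

  *-close : ∀ {A B α β ε} a b c d → 0ℚ ℚ.≤ α → 0ℚ ℚ.≤ β → ℚ.∣ a ∣ ℚ.≤ A → ℚ.∣ d ∣ ℚ.≤ B →
    ℚ.∣ b ℚ.- d ∣ ℚ.≤ α → ℚ.∣ a ℚ.- c ∣ ℚ.≤ β → A ℚ.* α ℚ.< ½ ℚ.* ε → B ℚ.* β ℚ.< ½ ℚ.* ε →
    ℚ.∣ a ℚ.* b ℚ.- c ℚ.* d ∣ ℚ.< ε
  *-close {A} {B} {α} {β} {ε} a b c d 0≤α 0≤β a≤A d≤B b-d≤α a-c≤β Aα<ε Bβ<ε = begin-strict
      ℚ.∣ a ℚ.* b ℚ.- c ℚ.* d ∣
        ≡⟨ cong ℚ.∣_∣ (solve 4 (λ a b c d → a :* b :- c :* d := a :* (b :- d) :+ d :* (a :- c)) refl a b c d) ⟩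
      ℚ.∣ a ℚ.* (b ℚ.- d) ℚ.+ d ℚ.* (a ℚ.- c) ∣
        ≤⟨ ℚ.∣p+q∣≤∣p∣+∣q∣ (a ℚ.* (b ℚ.- d)) (d ℚ.* (a ℚ.- c)) ⟩
      ℚ.∣ a ℚ.* (b ℚ.- d) ∣ ℚ.+ ℚ.∣ d ℚ.* (a ℚ.- c) ∣
        ≡⟨ cong₂ ℚ._+_ (ℚ.∣p*q∣≡∣p∣*∣q∣ a (b ℚ.- d)) (ℚ.∣p*q∣≡∣p∣*∣q∣ d (a ℚ.- c)) ⟩
      ℚ.∣ a ∣ ℚ.* ℚ.∣ b ℚ.- d ∣ ℚ.+ ℚ.∣ d ∣ ℚ.* ℚ.∣ a ℚ.- c ∣
        ≤⟨ ℚ.+-mono-≤ (*-mono (ℚ.0≤∣p∣ a) 0≤α a≤A b-d≤α) (*-mono (ℚ.0≤∣p∣ d) 0≤β d≤B a-c≤β) ⟩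
      A ℚ.* α ℚ.+ B ℚ.* β
        <⟨ ℚ.+-mono-< Aα<ε Bβ<ε ⟩
      ½ ℚ.* ε ℚ.+ ½ ℚ.* ε
        ≡⟨ half+half ε ⟩
      ε ∎
    where open ℚ.≤-Reasoning

  cauchy-* : ∀ {x y} → IsCauchy x → IsCauchy y → IsCauchy (λ n → x n ℚ.* y n)
  cauchy-* {x} {y} cx cy ε 0<ε =
    let A , K , 0≤A , ∣x∣≤A = eventually-bounded {x} cx
        B , L , 0≤B , ∣y∣≤B = eventually-bounded {y} cy
        α , 0<α , Aα<ε = small A 0≤A (half-pos 0<ε)
        β , 0<β , Bβ<ε = small B 0≤B (half-pos 0<ε)
        M , cx′ = cx β 0<β
        N , cy′ = cy α 0<α
        KL = K ℕ.⊔ L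
        MN = M ℕ.⊔ N
    in KL ℕ.⊔ MN , λ m n p q → *-close (x m) (y m) (x n) (y n) (ℚ.<⇒≤ 0<α) (ℚ.<⇒≤ 0<β)
      (∣x∣≤A m (ℕ.m⊔n≤o⇒m≤o K L (ℕ.m⊔n≤o⇒m≤o KL MN p)))
      (∣y∣≤B n (ℕ.m⊔n≤o⇒n≤o K L (ℕ.m⊔n≤o⇒m≤o KL MN q)))
      (ℚ.<⇒≤ (cy′ m n (ℕ.m⊔n≤o⇒n≤o M N (ℕ.m⊔n≤o⇒n≤o KL MN p)) (ℕ.m⊔n≤o⇒n≤o M N (ℕ.m⊔n≤o⇒n≤o KL MN q))))
      (ℚ.<⇒≤ (cx′ m n (ℕ.m⊔n≤o⇒m≤o M N (ℕ.m⊔n≤o⇒n≤o KL MN p)) (ℕ.m⊔n≤o⇒m≤o M N (ℕ.m⊔n≤o⇒n≤o KL MN q))))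
      Aα<ε Bβ<ε

fromℚ : ℚ → ℝ
fromℚ q = mkℝ (λ _ → q) (cauchy-const q)

infixl 6 _+ℝ_ _-ℝ_
infixl 7 _*ℝ_

_+ℝ_ _*ℝ_ _-ℝ_ : ℝ → ℝ → ℝ
x +ℝ y = mkℝ (λ n → seq x n ℚ.+ seq y n) (cauchy-+ {seq x} {seq y} (cauchy x) (cauchy y))
x *ℝ y = mkℝ (λ n → seq x n ℚ.* seq y n) (cauchy-* {seq x} {seq y} (cauchy x) (cauchy y))

negℝ absℝ : ℝ → ℝ
negℝ x = mkℝ (λ n → ℚ.- seq x n) (cauchy-neg {seq x} (cauchy x))
absℝ x = mkℝ (λ n → ℚ.∣ seq x n ∣) (cauchy-abs {seq x} (cauchy x))

x -ℝ y = x +ℝ negℝ y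

------------------------------------------------------------------------

-- ⌊√n⌋
isqrt : ℕ → ℕ
isqrt zero    = zero
isqrt (suc n) with suc (isqrt n) ℕ.* suc (isqrt n) ℕ.≤? suc n
... | yes _ = suc (isqrt n)
... | no  _ = isqrt n

-- ⌊ √(∣q∣ (n+1)²) ⌋ / (n+1), a lower approximation of √∣q∣ with error
-- less than 1/(n+1)
opaque
  √ℚ : ℕ → ℚ → ℚ
  √ℚ n q = + isqrt (ℤ.∣ ↥ q ∣ ℕ.* (suc n ℕ.* suc n) ℕ./ ↧ₙ q) ℚ./ suc n

isqrt-lower : ∀ n → isqrt n ℕ.* isqrt n ℕ.≤ n
isqrt-lower zero = ℕ.z≤n
isqrt-lower (suc n) with suc (isqrt n) ℕ.* suc (isqrt n) ℕ.≤? suc n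
... | yes p = p
... | no  _ = ℕ.m≤n⇒m≤1+n (isqrt-lower n)

isqrt-upper : ∀ n → n ℕ.< suc (isqrt n) ℕ.* suc (isqrt n)
isqrt-upper zero = ℕ.s≤s ℕ.z≤n
isqrt-upper (suc n) with suc (isqrt n) ℕ.* suc (isqrt n) ℕ.≤? suc n
... | yes _ = ℕ.≤-<-trans (isqrt-upper n) 
    (ℕ.*-mono-< {suc (isqrt n)} {suc (suc (isqrt n))} (ℕ.n<1+n (suc (isqrt n))) (ℕ.n<1+n (suc (isqrt n))))
... | no ¬p = ℕ.≰⇒> ¬p

frac²≃ : ∀ t n → toℚᵘ ((+ t ℚ./ suc n) ℚ.* (+ t ℚ./ suc n)) ℚᵘ.≃ ℚᵘ.mkℚᵘ (+ t) n ℚᵘ.* ℚᵘ.mkℚᵘ (+ t) n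
frac²≃ t n = ℚᵘ.≃-trans (ℚ.toℚᵘ-homo-* (+ t ℚ./ suc n) (+ t ℚ./ suc n))
  (ℚᵘ.*-cong (ℚ.toℚᵘ-fromℚᵘ (ℚᵘ.mkℚᵘ (+ t) n)) (ℚ.toℚᵘ-fromℚᵘ (ℚᵘ.mkℚᵘ (+ t) n)))

frac²-≤ : ∀ t n q → t ℕ.* t ℕ.* ↧ₙ q ℕ.≤ ℤ.∣ ↥ q ∣ ℕ.* (suc n ℕ.* suc n) →
  (+ t ℚ./ suc n) ℚ.* (+ t ℚ./ suc n) ℚ.≤ ℚ.∣ q ∣
frac²-≤ t n q@(mkℚ p d _) h = ℚ.toℚᵘ-cancel-≤
  (ℚᵘ.≤-respˡ-≃ (ℚᵘ.≃-sym (frac²≃ t n))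
  (ℚᵘ.≤-respʳ-≃ (ℚᵘ.≃-sym (ℚ.toℚᵘ-homo-∣-∣ q))
  (ℚᵘ.*≤* (subst₂ ℤ._≤_
    (trans (ℤ.pos-* (t ℕ.* t) (suc d)) (cong (ℤ._* + suc d) (ℤ.pos-* t t)))
    (ℤ.pos-* ℤ.∣ p ∣ (suc n ℕ.* suc n))
    (ℤ.+≤+ h)))))

frac²-> : ∀ t n q → ℤ.∣ ↥ q ∣ ℕ.* (suc n ℕ.* suc n) ℕ.< t ℕ.* t ℕ.* ↧ₙ q →
  ℚ.∣ q ∣ ℚ.< (+ t ℚ./ suc n) ℚ.* (+ t ℚ./ suc n)
frac²-> t n q@(mkℚ p d _) h = ℚ.toℚᵘ-cancel-<
  (ℚᵘ.<-respʳ-≃ (ℚᵘ.≃-sym (frac²≃ t n))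
  (ℚᵘ.<-respˡ-≃ (ℚᵘ.≃-sym (ℚ.toℚᵘ-homo-∣-∣ q))
  (ℚᵘ.*<* (subst₂ ℤ._<_
    (ℤ.pos-* ℤ.∣ p ∣ (suc n ℕ.* suc n))
    (trans (ℤ.pos-* (t ℕ.* t) (suc d)) (cong (ℤ._* + suc d) (ℤ.pos-* t t)))
    (ℤ.+<+ h)))))

frac-suc : ∀ t n → + suc t ℚ./ suc n ≡ (+ t ℚ./ suc n) ℚ.+ (+ 1 ℚ./ suc n)
frac-suc t n = ℚ.toℚᵘ-injective
  (ℚᵘ.≃-trans (ℚ.toℚᵘ-fromℚᵘ (ℚᵘ.mkℚᵘ (+ suc t) n))
  (ℚᵘ.≃-trans (ℚᵘ.*≡* eq)
  (ℚᵘ.≃-sym (ℚᵘ.≃-trans (ℚ.toℚᵘ-homo-+ (+ t ℚ./ suc n) (+ 1 ℚ./ suc n))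
    (ℚᵘ.+-cong (ℚ.toℚᵘ-fromℚᵘ (ℚᵘ.mkℚᵘ (+ t) n)) (ℚ.toℚᵘ-fromℚᵘ (ℚᵘ.mkℚᵘ (+ 1) n)))))))
  where
  N = + suc n
  eq : + suc t ℤ.* (N ℤ.* N) ≡ (+ t ℤ.* N ℤ.+ + 1 ℤ.* N) ℤ.* N
  eq = trans (sym (ℤ.*-assoc (+ suc t) N N)) (cong (ℤ._* N)
    (trans (cong (ℤ._* N) (ℤ.+-comm (+ 1) (+ t))) (ℤ.*-distribʳ-+ N (+ t) (+ 1))))

opaque
  unfolding √ℚ

  √ℚ-lower : ∀ n q → √ℚ n q ℚ.* √ℚ n q ℚ.≤ ℚ.∣ q ∣
  √ℚ-lower n q = frac²-≤ (isqrt f) n q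
    (ℕ.≤-trans (ℕ.*-monoˡ-≤ (↧ₙ q) (isqrt-lower f)) (ℕ.m/n*n≤m (ℤ.∣ ↥ q ∣ ℕ.* (suc n ℕ.* suc n)) (↧ₙ q)))
    where
    f : ℕ
    f = ℤ.∣ ↥ q ∣ ℕ.* (suc n ℕ.* suc n) ℕ./ ↧ₙ q

m<[1+m/n]*n : ∀ m n .{{_ : ℕ.NonZero n}} → m ℕ.< suc (m ℕ./ n) ℕ.* n
m<[1+m/n]*n m n = subst (ℕ._< suc (m ℕ./ n) ℕ.* n) (sym (ℕ.m≡m%n+[m/n]*n m n))
  (ℕ.+-monoˡ-< (m ℕ./ n ℕ.* n) (ℕ.m%n<n m n))

opaque
  unfolding √ℚ

  √ℚ-upper : ∀ n q → ℚ.∣ q ∣ ℚ.< (√ℚ n q ℚ.+ + 1 ℚ./ suc n) ℚ.* (√ℚ n q ℚ.+ + 1 ℚ./ suc n)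
  √ℚ-upper n q = subst (λ r → ℚ.∣ q ∣ ℚ.< r ℚ.* r) (frac-suc (isqrt f) n)
    (frac²-> (suc (isqrt f)) n q
      (ℕ.<-≤-trans (m<[1+m/n]*n (ℤ.∣ ↥ q ∣ ℕ.* (suc n ℕ.* suc n)) (↧ₙ q)) (ℕ.*-monoˡ-≤ (↧ₙ q) (isqrt-upper f))))
    where
    f : ℕ
    f = ℤ.∣ ↥ q ∣ ℕ.* (suc n ℕ.* suc n) ℕ./ ↧ₙ q

  √ℚ-nonNeg : ∀ n q → 0ℚ ℚ.≤ √ℚ n q
  √ℚ-nonNeg n q = ℚ.nonNegative⁻¹ (√ℚ n q) {{ℚ.normalize-nonNeg (isqrt (ℤ.∣ ↥ q ∣ ℕ.* (suc n ℕ.* suc n) ℕ./ ↧ₙ q)) (suc n)}}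

1/-nonNeg : ∀ n → 0ℚ ℚ.≤ + 1 ℚ./ suc n
1/-nonNeg n = ℚ.nonNegative⁻¹ (+ 1 ℚ./ suc n) {{ℚ.normalize-nonNeg 1 (suc n)}}

1/-small : ∀ {δ} → 0ℚ ℚ.< δ → ∃[ N ] ∀ n → N ℕ.≤ n → + 1 ℚ./ suc n ℚ.< δ
1/-small {δ@(mkℚ (+ suc p) d _)} 0<δ = suc d , λ n d≤n → ℚ.toℚᵘ-cancel-<
  (ℚᵘ.<-respˡ-≃ (ℚᵘ.≃-sym (ℚ.toℚᵘ-fromℚᵘ (ℚᵘ.mkℚᵘ (+ 1) n)))
    (ℚᵘ.*<* (ℤ.+<+ (ℕ.<-≤-trans (subst (ℕ._< suc n) (sym (ℕ.+-identityʳ (suc d))) (ℕ.s≤s d≤n))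
      (ℕ.m≤n*m (suc n) (suc p))))))
1/-small {mkℚ (+ zero) d _} (ℚ.*<* 0<0) = ⊥-elim (ℤ.<-irrefl refl 0<0)
1/-small {mkℚ ℤ.-[1+ p ] d _} (ℚ.*<* ())

√ℚ-diff : ∀ {h} m n a b → 0ℚ ℚ.≤ h → + 1 ℚ./ suc n ℚ.≤ h →
  ℚ.∣ a ∣ ℚ.- ℚ.∣ b ∣ ℚ.< h ℚ.* h → √ℚ m a ℚ.- √ℚ n b ℚ.< h ℚ.+ h
√ℚ-diff {h} m n a b 0≤h δ≤h a-b<h² with √ℚ m a ℚ.- √ℚ n b ℚ.<? h ℚ.+ h
... | yes p = p
... | no ¬p = ⊥-elim (ℚ.<-irrefl refl (begin-strict
    ℚ.∣ a ∣                                   ≡⟨ solve 2 (λ a b → a := b :+ (a :- b)) refl ℚ.∣ a ∣ ℚ.∣ b ∣ ⟩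
    ℚ.∣ b ∣ ℚ.+ (ℚ.∣ a ∣ ℚ.- ℚ.∣ b ∣)         <⟨ ℚ.+-mono-< (√ℚ-upper n b) a-b<h² ⟩
    (t ℚ.+ δ) ℚ.* (t ℚ.+ δ) ℚ.+ h ℚ.* h       ≤⟨ ℚ.+-monoˡ-≤ (h ℚ.* h) (*-mono 0≤t+δ 0≤u t+δ≤u t+δ≤u) ⟩
    u ℚ.* u ℚ.+ h ℚ.* h                       ≡⟨ sym (ℚ.+-identityʳ _) ⟩
    u ℚ.* u ℚ.+ h ℚ.* h ℚ.+ 0ℚ                ≤⟨ ℚ.+-monoʳ-≤ (u ℚ.* u ℚ.+ h ℚ.* h) 0≤2uh ⟩
    u ℚ.* u ℚ.+ h ℚ.* h ℚ.+ (u ℚ.* h ℚ.+ u ℚ.* h) ≡⟨ solve 2 (λ u h → ((u :* u) :+ (h :* h)) :+ ((u :* h) :+ (u :* h)) := (u :+ h) :* (u :+ h)) refl u h ⟩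
    (u ℚ.+ h) ℚ.* (u ℚ.+ h)                   ≤⟨ *-mono (ℚ.+-mono-≤ 0≤u 0≤h) (√ℚ-nonNeg m a) u+h≤s u+h≤s ⟩
    s ℚ.* s                                   ≤⟨ √ℚ-lower m a ⟩
    ℚ.∣ a ∣                                   ∎))
  where
  open ℚ.≤-Reasoning
  s = √ℚ m a
  t = √ℚ n b
  δ = + 1 ℚ./ suc n
  u = t ℚ.+ h
  0≤u : 0ℚ ℚ.≤ u
  0≤u = ℚ.+-mono-≤ (√ℚ-nonNeg n b) 0≤h
  0≤t+δ : 0ℚ ℚ.≤ t ℚ.+ δ
  0≤t+δ = ℚ.+-mono-≤ (√ℚ-nonNeg n b) (1/-nonNeg n)
  t+δ≤u : t ℚ.+ δ ℚ.≤ u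
  t+δ≤u = ℚ.+-monoʳ-≤ t δ≤h
  0≤uh : 0ℚ ℚ.≤ u ℚ.* h
  0≤uh = subst (ℚ._≤ u ℚ.* h) (ℚ.*-zeroʳ u) (ℚ.*-monoˡ-≤-nonNeg u {{ℚ.nonNegative 0≤u}} 0≤h)
  0≤2uh : 0ℚ ℚ.≤ u ℚ.* h ℚ.+ u ℚ.* h
  0≤2uh = ℚ.+-mono-≤ 0≤uh 0≤uh
  u+h≤s : u ℚ.+ h ℚ.≤ s
  u+h≤s = begin
    t ℚ.+ h ℚ.+ h     ≡⟨ ℚ.+-assoc t h h ⟩
    t ℚ.+ (h ℚ.+ h)   ≤⟨ ℚ.+-monoʳ-≤ t (ℚ.≮⇒≥ ¬p) ⟩
    t ℚ.+ (s ℚ.- t)   ≡⟨ solve 2 (λ t s → t :+ (s :- t) := s) refl t s ⟩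
    s                 ∎

opaque
  cauchy-√ : ∀ {x} → IsCauchy x → IsCauchy (λ n → √ℚ n (x n))
  cauchy-√ {x} cx ε 0<ε
    with h ← ½ ℚ.* ε in h≡ | 0<h ← half-pos 0<ε
    with cx (h ℚ.* h) (ℚ.positive⁻¹ (h ℚ.* h) {{ℚ.pos*pos⇒pos h {{ℚ.positive 0<h}} h {{ℚ.positive 0<h}}}}) | 1/-small 0<h
  ... | M , cx′ | N , 1/<h = M ℕ.⊔ N , λ m n p q → ∣p∣<ε
      (one m n (ℕ.m⊔n≤o⇒m≤o M N p) (ℕ.m⊔n≤o⇒m≤o M N q) (ℕ.m⊔n≤o⇒n≤o M N q))
      (subst (ℚ._< ε) (solve 2 (λ a b → b :- a := :- (a :- b)) refl (√ℚ m (x m)) (√ℚ n (x n)))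
        (one n m (ℕ.m⊔n≤o⇒m≤o M N q) (ℕ.m⊔n≤o⇒m≤o M N p) (ℕ.m⊔n≤o⇒n≤o M N p)))
    where
    one : ∀ m n → M ℕ.≤ m → M ℕ.≤ n → N ℕ.≤ n → √ℚ m (x m) ℚ.- √ℚ n (x n) ℚ.< ε
    one m n Mm Mn Nn = subst (√ℚ m (x m) ℚ.- √ℚ n (x n) ℚ.<_)
      (trans (cong₂ ℚ._+_ (sym h≡) (sym h≡)) (half+half ε))
      (√ℚ-diff m n (x m) (x n) (ℚ.<⇒≤ 0<h) (ℚ.<⇒≤ (1/<h n Nn))
        (ℚ.≤-<-trans (∣∣-diff (x m) (x n)) (cx′ m n Mm Mn)))

-- √∣ x ∣, the square root of the absolute value of x
√∣_∣ : ℝ → ℝ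
√∣ x ∣ = mkℝ (λ n → √ℚ n (seq x n)) (cauchy-√ {seq x} (cauchy x))

square-close : ∀ {B η ε} a s δ → 0ℚ ℚ.≤ s → 0ℚ ℚ.≤ δ → 0ℚ ℚ.≤ η → 0ℚ ℚ.< ε →
  s ℚ.* s ℚ.≤ a → a ℚ.< (s ℚ.+ δ) ℚ.* (s ℚ.+ δ) →
  s ℚ.≤ B → δ ℚ.≤ 1ℚ → δ ℚ.≤ η → (B ℚ.+ B ℚ.+ 1ℚ) ℚ.* η ℚ.< ε →
  ℚ.∣ s ℚ.* s ℚ.- a ∣ ℚ.< ε
square-close {B} {η} {ε} a s δ 0≤s 0≤δ 0≤η 0<ε s²≤a a<[s+δ]² s≤B δ≤1 δ≤η Cη<ε = ∣p∣<ε
  (begin-strict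
    s ℚ.* s ℚ.- a                           ≤⟨ ℚ.+-monoˡ-≤ (ℚ.- a) s²≤a ⟩
    a ℚ.- a                                 ≡⟨ ℚ.+-inverseʳ a ⟩
    0ℚ                                      <⟨ 0<ε ⟩
    ε                                       ∎)
  (begin-strict
    ℚ.- (s ℚ.* s ℚ.- a)                     ≡⟨ solve 2 (λ a b → :- (a :- b) := b :- a) refl (s ℚ.* s) a ⟩
    a ℚ.- s ℚ.* s                           <⟨ ℚ.+-monoˡ-< (ℚ.- (s ℚ.* s)) a<[s+δ]² ⟩
    (s ℚ.+ δ) ℚ.* (s ℚ.+ δ) ℚ.- s ℚ.* s     ≡⟨ solve 2 (λ s d → (s :+ d) :* (s :+ d) :- s :* s := ((s :+ s) :+ d) :* d) refl s δ ⟩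
    (s ℚ.+ s ℚ.+ δ) ℚ.* δ                   ≤⟨ *-mono (ℚ.+-mono-≤ (ℚ.+-mono-≤ 0≤s 0≤s) 0≤δ) 0≤η
                                                 (ℚ.+-mono-≤ (ℚ.+-mono-≤ s≤B s≤B) δ≤1) δ≤η ⟩
    (B ℚ.+ B ℚ.+ 1ℚ) ℚ.* η                  <⟨ Cη<ε ⟩
    ε                                       ∎)
  where open ℚ.≤-Reasoning

√∣∣-square : ∀ x → √∣ x ∣ *ℝ √∣ x ∣ ≈ℝ absℝ x
√∣∣-square x ε 0<ε =
  let B , K , 0≤B , ∣s∣≤B = eventually-bounded {seq √∣ x ∣} (cauchy √∣ x ∣)
      η , 0<η , Cη<ε = small (B ℚ.+ B ℚ.+ 1ℚ)
        (ℚ.+-mono-≤ (ℚ.+-mono-≤ 0≤B 0≤B) (ℚ.<⇒≤ (ℚ.positive⁻¹ 1ℚ))) 0<ε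
      N , δ<η = 1/-small 0<η
      L , δ<1 = 1/-small (ℚ.positive⁻¹ 1ℚ)
      NL = N ℕ.⊔ L
  in K ℕ.⊔ NL , λ n p → square-close ℚ.∣ seq x n ∣ (√ℚ n (seq x n)) (+ 1 ℚ./ suc n)
    (√ℚ-nonNeg n (seq x n)) (1/-nonNeg n) (ℚ.<⇒≤ 0<η) 0<ε
    (√ℚ-lower n (seq x n)) (√ℚ-upper n (seq x n))
    (ℚ.≤-trans (p≤∣p∣ (√ℚ n (seq x n))) (∣s∣≤B n (ℕ.m⊔n≤o⇒m≤o K NL p)))
    (ℚ.<⇒≤ (δ<1 n (ℕ.m⊔n≤o⇒n≤o N L (ℕ.m⊔n≤o⇒n≤o K NL p))))
    (ℚ.<⇒≤ (δ<η n (ℕ.m⊔n≤o⇒m≤o N L (ℕ.m⊔n≤o⇒n≤o K NL p))))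
    Cη<ε

------------------------------------------------------------------------

record ℂ : Set where
  constructor _+i_
  field
    re im : ℝ

open ℂ public

infix  4 _≈ℂ_
infixl 6 _+ℂ_ _-ℂ_
infixl 7 _*ℂ_

_≈ℂ_ : Rel ℂ 0ℓ
z ≈ℂ w = re z ≈ℝ re w × im z ≈ℝ im w

0ℂ 1ℂ : ℂ
0ℂ = fromℚ 0ℚ +i fromℚ 0ℚ
1ℂ = fromℚ 1ℚ +i fromℚ 0ℚ

_+ℂ_ _-ℂ_ _*ℂ_ : ℂ → ℂ → ℂ
z +ℂ w = (re z +ℝ re w) +i (im z +ℝ im w)
z -ℂ w = (re z -ℝ re w) +i (im z -ℝ im w)
z *ℂ w = (re z *ℝ re w -ℝ im z *ℝ im w) +i (re z *ℝ im w +ℝ im z *ℝ re w)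

∣_∣ℂ : ℂ → ℝ
∣ z ∣ℂ = √∣ re z *ℝ re z +ℝ im z *ℝ im z ∣

------------------------------------------------------------------------
-- Sums. A list without repetitions stands for a finite subset of the
-- index set, and HasSum is unconditional convergence along the finite
-- subsets.

Σℝ : {I : Set} → List I → (I → ℝ) → ℝ
Σℝ F f = foldr (λ i s → f i +ℝ s) (fromℚ 0ℚ) F

Σℂ : {I : Set} → List I → (I → ℂ) → ℂ
Σℂ F f = foldr (λ i s → f i +ℂ s) 0ℂ F

HasSumℝ : {I : Set} → (I → ℝ) → ℝ → Set
HasSumℝ {I} f s = ∀ ε → 0ℚ ℚ.< ε →
  ∃[ F ] ∀ (G : List I) → Unique G → F ⊆ G → absℝ (Σℝ G f -ℝ s) ≤ℝ fromℚ ε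

HasSumℂ : {I : Set} → (I → ℂ) → ℂ → Set
HasSumℂ {I} f s = ∀ ε → 0ℚ ℚ.< ε →
  ∃[ F ] ∀ (G : List I) → Unique G → F ⊆ G → ∣ Σℂ G f -ℂ s ∣ℂ ≤ℝ fromℚ ε

------------------------------------------------------------------------
-- Free vector spaces. A formal linear combination is a list of terms;
-- two of them are identified when all their coefficients agree.

module _ (D : DecSetoid 0ℓ 0ℓ) where

  open DecSetoid D using (Carrier; _≟_)

  FormalSum : Set
  FormalSum = List (ℂ × Carrier)

  coefficient : FormalSum → Carrier → ℂ
  coefficient x d = Σℂ x (λ (c , e) → if does (e ≟ d) then c else 0ℂ)

  SameSum : Rel FormalSum 0ℓ
  SameSum x y = ∀ d → coefficient x d ≈ℂ coefficient y d

linearCombination : {X I : Set} → List (ℂ × X) → (X → I → ℂ) → I → ℂ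
linearCombination x f i = Σℂ x (λ (c , d) → c *ℂ f d i)

_≈ᶠ_ : {I : Set} → Rel (I → ℂ) 0ℓ
f ≈ᶠ g = ∀ i → f i ≈ℂ g i

record IsBasis {I : Set} (Subspace : (I → ℂ) → Set)
               (D : DecSetoid 0ℓ 0ℓ) (b : DecSetoid.Carrier D → I → ℂ) : Set where
  field
    member      : (d : DecSetoid.Carrier D) → Subspace (b d)
    spanning    : (v : I → ℂ) → Subspace v → ∃[ x ] v ≈ᶠ linearCombination x b
    independent : (x : FormalSum D) → linearCombination x b ≈ᶠ (λ _ → 0ℂ) → SameSum D x []

------------------------------------------------------------------------
-- Set partitions, given by the equivalence relation "in the same block"

record SetPartition (X : Set) : Set where
  field
    sameBlock     : X → X → Bool
    isEquivalence : IsEquivalence (λ x y → T (sameBlock x y))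

  _∼_ : Rel X 0ℓ
  x ∼ y = T (sameBlock x y)

  open IsEquivalence isEquivalence public
    renaming (refl to ∼-refl; sym to ∼-sym; trans to ∼-trans; reflexive to ∼-reflexive)

open SetPartition using (sameBlock; _∼_; ∼-refl; ∼-sym; ∼-trans)

SamePartition : {X : Set} → Rel (SetPartition X) 0ℓ
SamePartition π ρ = ∀ x y → sameBlock π x y ≡ sameBlock ρ x y

Exhaustible : Set → Set₁
Exhaustible X = ∀ {P : X → Set} → (∀ x → Dec (P x)) → Dec (∀ x → P x)

partitionDecSetoid : {X : Set} → Exhaustible X → DecSetoid 0ℓ 0ℓ
partitionDecSetoid {X} every? = record
  { Carrier = SetPartition X
  ; _≈_ = SamePartition
  ; isDecEquivalence = record
    { isEquivalence = record
      { refl  = λ _ _ → refl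
      ; sym   = λ p x y → sym (p x y)
      ; trans = λ p q x y → trans (p x y) (q x y)
      }
    ; _≟_ = λ π ρ → every? λ x → every? λ y → sameBlock π x y ≟ᵇ sameBlock ρ x y
    }
  }

Partitions : ℕ → DecSetoid 0ℓ 0ℓ
Partitions k = partitionDecSetoid {Fin k} all?

------------------------------------------------------------------------
-- The finitary symmetric group and its action on functions on ℕᵏ. Only
-- the countably infinite index set matters, so it is taken to be the
-- library's ℕ, starting at 0.

record S∞ : Set where
  field
    permutation   : ℕ ↔ ℕ
    support       : List ℕ
    fixes-outside : ∀ n → n ∉ support → Inverse.to permutation n ≡ n

  open Inverse permutation public using (to; from)

Index : ℕ → Set
Index k = Vec ℕ k

infixr 7 _·_

_·_ : ∀ {k} → S∞ → (Index k → ℂ) → (Index k → ℂ)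
(σ · v) i = v (Vec.map (S∞.from σ) i)

_≟ⁱ_ : ∀ {k} → DecidableEquality (Index k)
_≟ⁱ_ = Vec.≡-dec ℕ._≟_

indicator : ∀ {k} → Index k → Index k → ℂ
indicator i j = if does (i ≟ⁱ j) then 1ℂ else 0ℂ

Bounded : ∀ {k} → (Index k → ℂ) → Set
Bounded v = ∃[ M ] ∀ i → ∣ v i ∣ℂ ≤ℝ M

Invariant : ∀ {k} → (Index k → ℂ) → Set
Invariant v = ∀ σ → (σ · v) ≈ᶠ v

ℓ∞-Invariants : ∀ k → (Index k → ℂ) → Set
ℓ∞-Invariants k v = Bounded v × Invariant v

ConstantOnBlocks : ∀ {k} → SetPartition (Fin k) → Index k → Set
ConstantOnBlocks π i = ∀ l m → _∼_ π l m → lookup i l ≡ lookup i m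

constantOnBlocks? : ∀ {k} (π : SetPartition (Fin k)) i → Dec (ConstantOnBlocks π i)
constantOnBlocks? π i = all? λ l → all? λ m →
  T? (sameBlock π l m) →-dec (lookup i l ℕ.≟ lookup i m)

m⟨_⟩ : ∀ {k} → SetPartition (Fin k) → Index k → ℂ
m⟨ π ⟩ i = if does (constantOnBlocks? π i) then 1ℂ else 0ℂ

------------------------------------------------------------------------
-- Matrices; A i j is the entry with lower index i and upper index j, so
-- that (A v) j = Σᵢ A i j * v i.

Matrix : ℕ → Set
Matrix k = Index k → Index k → ℂ

_≈ᴹ_ : ∀ {k} → Rel (Matrix k) 0ℓ
A ≈ᴹ B = ∀ i j → A i j ≈ℂ B i j

_+ᴹ_ : ∀ {k} → Matrix k → Matrix k → Matrix k
(A +ᴹ B) i j = A i j +ℂ B i j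

_*ᴹ_ : ∀ {k} → ℂ → Matrix k → Matrix k
(c *ᴹ A) i j = c *ℂ A i j

IdentityMatrix : ∀ {k} → Matrix k
IdentityMatrix = indicator

-- ‖A‖ < ∞: every Σᵢ ∣A i j∣ converges, and these sums have a common
-- bound.
B-Mat : ∀ {k} → Matrix k → Set
B-Mat A = ∃[ M ] ∀ j → ∃[ s ] HasSumℝ (λ i → ∣ A i j ∣ℂ) s × s ≤ℝ M

-- C = A B. The product is a relation because its entries are infinite
-- sums; these converge when A and B are in B-Mat.
IsProduct : ∀ {k} → Matrix k → Matrix k → Matrix k → Set
IsProduct A B C = ∀ i l → HasSumℂ (λ j → A j l *ℂ B i j) (C i l)

-- The matrix of σ on ℓ∞: its i-th column is σ · vᵢ.
permutationMatrix : ∀ {k} → S∞ → Matrix k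
permutationMatrix σ i = σ · indicator i

Commute : ∀ {k} → Matrix k → Matrix k → Set
Commute A B = ∃[ C ] IsProduct A B C × IsProduct B A C

Centralizer : ∀ k → Matrix k → Set
Centralizer k A = B-Mat A × (∀ σ → Commute (permutationMatrix σ) A)

------------------------------------------------------------------------

Vertex : ℕ → Set
Vertex k = Fin k ⊎ Fin k

pattern top l    = inj₁ l
pattern bottom l = inj₂ l

IsBottom : ∀ {k} → Vertex k → Set
IsBottom (top _)    = ⊥
IsBottom (bottom _) = ⊤

Diagram : ℕ → Set
Diagram k = SetPartition (Vertex k)

everyVertex? : ∀ {k} → Exhaustible (Vertex k)
everyVertex? P? = map′
  (λ (p , q) → λ { (top l) → p l ; (bottom l) → q l })
  (λ p → (λ l → p (top l)) , (λ l → p (bottom l)))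
  (all? (λ l → P? (top l)) ×-dec all? (λ l → P? (bottom l)))

data StackedVertex (k : ℕ) : Set where
  upper middle lower : Fin k → StackedVertex k

placeAbove placeBelow : ∀ {k} → Vertex k → StackedVertex k
placeAbove (top l)    = upper l
placeAbove (bottom l) = middle l
placeBelow (top l)    = middle l
placeBelow (bottom l) = lower l

outer : ∀ {k} → Vertex k → StackedVertex k
outer (top l)    = upper l
outer (bottom l) = lower l

data Edge {k} (d₁ d₂ : Diagram k) : Rel (StackedVertex k) 0ℓ where
  above : ∀ {x y} → _∼_ d₁ x y → Edge d₁ d₂ (placeAbove x) (placeAbove y)
  below : ∀ {x y} → _∼_ d₂ x y → Edge d₁ d₂ (placeBelow x) (placeBelow y)

Connected : ∀ {k} → Diagram k → Diagram k → Rel (StackedVertex k) 0ℓ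
Connected d₁ d₂ = EqClosure (Edge d₁ d₂)

_≟ˢ_ : ∀ {k} → DecidableEquality (StackedVertex k)
upper l  ≟ˢ upper m  = map′ (cong upper) (λ { refl → refl }) (l ≟ᶠ m)
upper _  ≟ˢ middle _ = no λ ()
upper _  ≟ˢ lower _  = no λ ()
middle _ ≟ˢ upper _  = no λ ()
middle l ≟ˢ middle m = map′ (cong middle) (λ { refl → refl }) (l ≟ᶠ m)
middle _ ≟ˢ lower _  = no λ ()
lower _  ≟ˢ upper _  = no λ ()
lower _  ≟ˢ middle _ = no λ ()
lower l  ≟ˢ lower m  = map′ (cong lower) (λ { refl → refl }) (l ≟ᶠ m)

module _ {V : Set} (_≟_ : DecidableEquality V) where

  Joined : List (V × V) → Rel V 0ℓ
  Joined es = EqClosure (λ x y → (x , y) ∈ es)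

  Merged : V → V → List (V × V) → Rel V 0ℓ
  Merged a b es x y = Joined es x y
    ⊎ (Joined es x a × Joined es b y) ⊎ (Joined es x b × Joined es a y)

  private
    weaken : ∀ {e es x y} → Joined es x y → Joined (e ∷ es) x y
    weaken = Eq.map there

    flip-joined : ∀ {es x y} → Joined es x y → Joined es y x
    flip-joined = Eq.symmetric _

    merged⇒joined : ∀ {a b es x y} → Merged a b es x y → Joined ((a , b) ∷ es) x y
    merged⇒joined (inj₁ p)              = weaken p
    merged⇒joined (inj₂ (inj₁ (p , q))) = weaken p ◅◅ (fwd (here refl) ◅ weaken q)
    merged⇒joined (inj₂ (inj₂ (p , q))) = weaken p ◅◅ (bwd (here refl) ◅ weaken q)

    prepend : ∀ {a b es x y z} → Joined es x y → Merged a b es y z → Merged a b es x z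
    prepend p (inj₁ q)              = inj₁ (p ◅◅ q)
    prepend p (inj₂ (inj₁ (q , r))) = inj₂ (inj₁ (p ◅◅ q , r))
    prepend p (inj₂ (inj₂ (q , r))) = inj₂ (inj₂ (p ◅◅ q , r))

    crossˡ : ∀ {a b es z} → Merged a b es b z → Merged a b es a z
    crossˡ (inj₁ q)              = inj₂ (inj₁ (stop , q))
    crossˡ (inj₂ (inj₁ (q , r))) = inj₁ (flip-joined q ◅◅ r)
    crossˡ (inj₂ (inj₂ (q , r))) = inj₁ r

    crossʳ : ∀ {a b es z} → Merged a b es a z → Merged a b es b z
    crossʳ (inj₁ q)              = inj₂ (inj₂ (stop , q))
    crossʳ (inj₂ (inj₁ (q , r))) = inj₁ r
    crossʳ (inj₂ (inj₂ (q , r))) = inj₁ (flip-joined q ◅◅ r)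

    joined⇒merged : ∀ {a b es x y} → Joined ((a , b) ∷ es) x y → Merged a b es x y
    joined⇒merged stop                        = inj₁ stop
    joined⇒merged (fwd (here refl) ◅ p)       = crossˡ (joined⇒merged p)
    joined⇒merged (bwd (here refl) ◅ p)       = crossʳ (joined⇒merged p)
    joined⇒merged (fwd (there e) ◅ p)         = prepend (fwd e ◅ stop) (joined⇒merged p)
    joined⇒merged (bwd (there e) ◅ p)         = prepend (bwd e ◅ stop) (joined⇒merged p)

    joined-[] : ∀ {x y} → Joined [] x y → x ≡ y
    joined-[] stop         = refl
    joined-[] (fwd () ◅ _)
    joined-[] (bwd () ◅ _)

  joined? : ∀ es → Decidable (Joined es)
  joined? []             x y = map′ (λ { refl → stop }) joined-[] (x ≟ y)
  joined? ((a , b) ∷ es) x y = map′ merged⇒joined joined⇒merged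
    (joined? es x y
      ⊎-dec (joined? es x a ×-dec joined? es b y)
      ⊎-dec (joined? es x b ×-dec joined? es a y))

T-does⁺ : {A : Set} (a? : Dec A) → A → T (does a?)
T-does⁺ (yes _) _ = tt
T-does⁺ (no ¬a) a = ¬a a

T-does⁻ : {A : Set} (a? : Dec A) → T (does a?) → A
T-does⁻ (yes a) _ = a

vertices : ∀ k → List (Vertex k)
vertices k = map inj₁ (allFin k) ++ map inj₂ (allFin k)

∈-vertices : ∀ {k} (x : Vertex k) → x ∈ vertices k
∈-vertices     (top l)    = ∈-++⁺ˡ (∈-map⁺ inj₁ (∈-allFin l))
∈-vertices {k} (bottom l) = ∈-++⁺ʳ (map inj₁ (allFin k)) (∈-map⁺ inj₂ (∈-allFin l))

relatedPairs : ∀ {k} → Diagram k → List (Vertex k × Vertex k)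
relatedPairs {k} d = filter (λ (x , y) → T? (sameBlock d x y)) (cartesianProduct (vertices k) (vertices k))

edges : ∀ {k} → Diagram k → Diagram k → List (StackedVertex k × StackedVertex k)
edges d₁ d₂ = map (λ (x , y) → placeAbove x , placeAbove y) (relatedPairs d₁)
           ++ map (λ (x , y) → placeBelow x , placeBelow y) (relatedPairs d₂)

edge⇒∈ : ∀ {k} {d₁ d₂ : Diagram k} {u v} → Edge d₁ d₂ u v → (u , v) ∈ edges d₁ d₂
edge⇒∈ {d₁ = d₁} (above {x} {y} p) = ∈-++⁺ˡ (∈-map⁺ _
  (∈-filter⁺ (λ (x , y) → T? (sameBlock d₁ x y)) (∈-cartesianProduct⁺ (∈-vertices x) (∈-vertices y)) p))
edge⇒∈ {d₁ = d₁} {d₂} (below {x} {y} p) = ∈-++⁺ʳ (map _ (relatedPairs d₁)) (∈-map⁺ _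
  (∈-filter⁺ (λ (x , y) → T? (sameBlock d₂ x y)) (∈-cartesianProduct⁺ (∈-vertices x) (∈-vertices y)) p))

∈⇒edge : ∀ {k} {d₁ d₂ : Diagram k} {u v} → (u , v) ∈ edges d₁ d₂ → Edge d₁ d₂ u v
∈⇒edge {k} {d₁} {d₂} e with ∈-++⁻ (map (λ (x , y) → placeAbove x , placeAbove y) (relatedPairs d₁)) e
... | inj₁ p with ∈-map⁻ _ p
...   | (x , y) , q , refl = above (proj₂ (∈-filter⁻ (λ (x , y) → T? (sameBlock d₁ x y)) {xs = cartesianProduct (vertices k) (vertices k)} q))
∈⇒edge {k} {d₁} {d₂} e | inj₂ p with ∈-map⁻ _ p
...   | (x , y) , q , refl = below (proj₂ (∈-filter⁻ (λ (x , y) → T? (sameBlock d₂ x y)) {xs = cartesianProduct (vertices k) (vertices k)} q))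

opaque
  connected? : ∀ {k} (d₁ d₂ : Diagram k) → Decidable (Connected d₁ d₂)
  connected? d₁ d₂ u v = map′ (Eq.map ∈⇒edge) (Eq.map edge⇒∈) (joined? _≟ˢ_ (edges d₁ d₂) u v)

infixl 7 _∗_

_∗_ : ∀ {k} → Diagram k → Diagram k → Diagram k
d₁ ∗ d₂ = record
  { sameBlock = λ x y → does (x ≟∗ y)
  ; isEquivalence = record
    { refl  = λ {x} → T-does⁺ (x ≟∗ x) stop
    ; sym   = λ {x} {y} p → T-does⁺ (y ≟∗ x) (Eq.symmetric _ (T-does⁻ (x ≟∗ y) p))
    ; trans = λ {x} {y} {z} p q → T-does⁺ (x ≟∗ z) (T-does⁻ (x ≟∗ y) p ◅◅ T-does⁻ (y ≟∗ z) q)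
    }
  }
  where
  _≟∗_ : ∀ x y → Dec (Connected d₁ d₂ (outer x) (outer y))
  x ≟∗ y = connected? d₁ d₂ (outer x) (outer y)

column : ∀ {k} → Vertex k → Fin k
column (top l)    = l
column (bottom l) = l

identityDiagram : ∀ {k} → Diagram k
identityDiagram = record
  { sameBlock = λ x y → does (column x ≟ᶠ column y)
  ; isEquivalence = record
    { refl  = λ {x} → T-does⁺ (column x ≟ᶠ column x) refl
    ; sym   = λ {x} {y} p → T-does⁺ (column y ≟ᶠ column x)
                (sym (T-does⁻ (column x ≟ᶠ column y) p))
    ; trans = λ {x} {y} {z} p q → T-does⁺ (column x ≟ᶠ column z)
                (trans (T-does⁻ (column x ≟ᶠ column y) p) (T-does⁻ (column y ≟ᶠ column z) q))
    }
  }

------------------------------------------------------------------------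

-- No block (they are all blocks of some vertex x) is contained in the
-- bottom row.
BottomPropagating : ∀ {k} → Diagram k → Set
BottomPropagating d = ∀ x → ¬ (∀ y → _∼_ d x y → IsBottom y)

record BPDiagram (k : ℕ) : Set where
  field
    diagram           : Diagram k
    bottomPropagating : BottomPropagating diagram

open BPDiagram public

BPDiagrams : ℕ → DecSetoid 0ℓ 0ℓ
BPDiagrams k = On.decSetoid (partitionDecSetoid {Vertex k} everyVertex?) (diagram {k})

∗-bottomPropagating : ∀ {k} {d₁ d₂ : Diagram k} →
  BottomPropagating d₁ → BottomPropagating d₂ → BottomPropagating (d₁ ∗ d₂)
∗-bottomPropagating {d₁ = d₁} {d₂} bp₁ bp₂ (top l)    h = h (top l) (∼-refl (d₁ ∗ d₂) {top l})
∗-bottomPropagating {d₁ = d₁} {d₂} bp₁ bp₂ (bottom l) h = bp₂ (bottom l) λ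
  { (bottom _) _ → tt
  ; (top m) p → ⊥-elim (bp₁ (bottom m) λ
    { (bottom _) _ → tt
    ; (top n) q → h (top n) (T-does⁺ (connected? d₁ d₂ (lower l) (upper n))
        (fwd (below p) ◅ fwd (above q) ◅ stop))
    })
  }

identity-bottomPropagating : ∀ {k} → BottomPropagating (identityDiagram {k})
identity-bottomPropagating x h =
  h (top (column x)) (T-does⁺ (column x ≟ᶠ column x) refl)

_∗ᴮ_ : ∀ {k} → BPDiagram k → BPDiagram k → BPDiagram k
d₁ ∗ᴮ d₂ = record
  { diagram = diagram d₁ ∗ diagram d₂
  ; bottomPropagating = ∗-bottomPropagating {d₁ = diagram d₁} {diagram d₂}
      (bottomPropagating d₁) (bottomPropagating d₂)
  }

BP : ℕ → Set
BP k = FormalSum (BPDiagrams k)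

module _ {k : ℕ} where

  infix  4 _≈ᴮ_
  infixl 6 _+ᴮ_
  infixl 7 _*ᴮ_ _•ᴮ_

  _≈ᴮ_ : Rel (BP k) 0ℓ
  _≈ᴮ_ = SameSum (BPDiagrams k)

  _+ᴮ_ _*ᴮ_ : BP k → BP k → BP k
  x +ᴮ y = x ++ y
  x *ᴮ y = cartesianProductWith (λ (a , d) (b , e) → a *ℂ b , d ∗ᴮ e) x y

  _•ᴮ_ : ℂ → BP k → BP k
  c •ᴮ x = map (λ (a , d) → c *ℂ a , d) x

  1ᴮ : BP k
  1ᴮ = (1ℂ , record { diagram = identityDiagram ; bottomPropagating = identity-bottomPropagating }) ∷ []

BP-FiniteDimensional : ℕ → Set
BP-FiniteDimensional k = ∃[ n ] ∃ λ (b : Fin n → BP k) → ∀ x → ∃ λ (c : Fin n → ℂ) →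
  x ≈ᴮ concatMap (λ l → c l •ᴮ b l) (allFin n)

-- An isomorphism of ℂ-algebras onto the centralizer of ℂS∞ in B-Mat.
record IsCentralizerIso (k : ℕ) (φ : BP k → Matrix k) : Set where
  field
    φ-centralizes : ∀ x → Centralizer k (φ x)
    φ-cong        : ∀ x y → x ≈ᴮ y → φ x ≈ᴹ φ y
    φ-+           : ∀ x y → φ (x +ᴮ y) ≈ᴹ (φ x +ᴹ φ y)
    φ-•           : ∀ c x → φ (c •ᴮ x) ≈ᴹ (c *ᴹ φ x)
    φ-*           : ∀ x y → IsProduct (φ x) (φ y) (φ (x *ᴮ y))
    φ-1           : φ 1ᴮ ≈ᴹ IdentityMatrix
    φ-injective   : ∀ x y → φ x ≈ᴹ φ y → x ≈ᴮ y
    φ-surjective  : ∀ A → Centralizer k A → ∃[ x ] φ x ≈ᴹ A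

{-# OPTIONS --safe #-}

-- Two labellings of a finite set by natural numbers lie in the same
-- S∞-orbit exactly when they have the same kernel partition, so an
-- invariant function is a function on partitions. The function m_π
-- corresponds to the indicator of the partitions coarser than π, and the
-- triangularity of this system with respect to refinement gives the
-- basis.
--
-- In the same way a matrix commuting with S∞ is a function on diagrams,
-- the entry with lower index i and upper index j being governed by the
-- kernel of the labelling of the bottom row by i and of the top row by j.
-- If some block of this kernel is isolated to the bottom row, its label
-- can be replaced by infinitely many fresh ones, so that column j contains
-- infinitely many equal entries and summability forces them to vanish. For
-- a bottom-propagating diagram d, on the other hand, j determines the only
-- i for which the entry of d is nonzero. All sums are therefore finite,
-- and the matrix product is the stacking of diagrams.
module Submission where

open import Algebra.Bundles using (CommutativeMonoid; AbelianGroup)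
import Algebra.Properties.CommutativeSemigroup as CommutativeSemigroupProperties
import Algebra.Properties.Group as GroupProperties
open import Data.Bool using (Bool; true; false; T; if_then_else_; not; _∧_)
open import Data.Bool.Properties using (T?)
open import Data.Empty using (⊥-elim)
open import Data.Fin using (Fin)
open import Data.Fin.Properties using (all?; any?; ¬∀⟶∃¬) renaming (_≟_ to _≟ᶠ_)
open import Data.Integer using (+_)
open import Data.List as List using (List; []; _∷_; _++_; map; foldr; length; upTo; allFin; concatMap; deduplicate; cartesianProduct; cartesianProductWith)
import Data.List.Properties as List
open import Data.List.Extrema.Nat using (max; xs≤max)
open import Data.List.Membership.Propositional using (_∈_; _∉_)
open import Data.List.Membership.Propositional.Properties using (∈-∃++; ∈-map⁺; ∈-++⁺ˡ; ∈-++⁺ʳ; ∈-concatMap⁺; ∈-allFin; ∈-upTo⁺; ∈-cartesianProduct⁺; ∈-cartesianProductWith⁺; ∈-deduplicate⁺; ∈-deduplicate⁻)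
import Data.List.Membership.Setoid as SetoidMembership
import Data.List.Membership.Setoid.Properties as SetoidMembershipₚ
open import Data.List.Relation.Binary.Permutation.Propositional using (↭⇒↭ₛ; ↭-sym)
open import Data.List.Relation.Binary.Permutation.Propositional.Properties using (shift; ∈-resp-↭)
import Data.List.Relation.Binary.Permutation.Setoid.Properties as Permutation
open import Data.List.Relation.Binary.Subset.Propositional using (_⊆_)
import Data.List.Relation.Unary.All as All
open import Data.List.Relation.Unary.AllPairs using (AllPairs; []; _∷_)
open import Data.List.Relation.Unary.Any as Any using (Any; here; there)
import Data.List.Relation.Unary.Unique.DecPropositional.Properties as DecUnique
import Data.List.Relation.Unary.Unique.DecSetoid.Properties as DecSetoidUnique
open import Data.List.Relation.Unary.Unique.Propositional using (Unique)
open import Data.Nat as ℕ using (ℕ; zero; suc; _≤_)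
import Data.Nat.Properties as ℕ
open import Data.Product using (∃-syntax; _×_; _,_; proj₁; proj₂; uncurry)
open import Data.Rational as ℚ using (ℚ; 0ℚ; 1ℚ; ½)
import Data.Rational.Properties as ℚ
open import Data.Rational.Solver using (module +-*-Solver)
open import Data.Sum using (_⊎_; inj₁; inj₂)
import Data.Sum.Properties as Sum
open import Data.Unit using (tt)
open import Data.Vec as Vec using (lookup; tabulate)
open import Data.Vec.Membership.Propositional.Properties using (∈-lookup; ∈-toList⁺)
import Data.Vec.Properties as Vec
open import Function using (_∘_; Inverse; mk↔ₛ′; mk⇔)
open import Level using (0ℓ)
open import Relation.Binary using (Rel; Decidable; DecidableEquality; Transitive; DecSetoid)
import Relation.Binary.Construct.Closure.Equivalence as Eq
open import Relation.Binary.Construct.Closure.ReflexiveTransitive using (_◅_; _◅◅_) renaming (ε to stop)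
open import Relation.Binary.Construct.Closure.Symmetric using (fwd)
open import Relation.Binary.PropositionalEquality as ≡ using (_≡_; refl; sym; trans; cong; cong₂; subst)
import Relation.Binary.Reasoning.Setoid as SetoidReasoning
open import Relation.Nullary using (¬_; Dec; yes; no; does; ¬?; contradiction)
open import Relation.Nullary.Decidable using (does-⇔; dec-true; dec-false; _×-dec_; _→-dec_)
open import Defs

open SetPartition using (sameBlock; _∼_; ∼-refl; ∼-sym; ∼-trans)
open +-*-Solver using (solve; _:=_; _:+_; _:*_; _:-_; :-_; con)

-- Finite sums in a commutative monoid

module FiniteSums (M : CommutativeMonoid 0ℓ 0ℓ) where

  open CommutativeMonoid M renaming (refl to ≈-refl; sym to ≈-sym; trans to ≈-trans)
  open CommutativeSemigroupProperties commutativeSemigroup using (x∙yz≈y∙xz; interchange)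

  -- Written with the same `foldr` as `Σℝ` and `Σℂ`, so that at the additive groups of `ℝ` and `ℂ`
  -- it unfolds to them and the lemmas below apply directly.
  Σ : {I : Set} → List I → (I → Carrier) → Carrier
  Σ F f = foldr (λ i s → f i ∙ s) ε F

  module _ {I : Set} where

    Σ-cong : ∀ F {f g : I → Carrier} → (∀ i → i ∈ F → f i ≈ g i) → Σ F f ≈ Σ F g
    Σ-cong []      h = ≈-refl
    Σ-cong (i ∷ F) h = ∙-cong (h i (here refl)) (Σ-cong F λ j j∈F → h j (there j∈F))

    Σ-ε : ∀ F {f : I → Carrier} → (∀ i → i ∈ F → f i ≈ ε) → Σ F f ≈ ε
    Σ-ε []      h = ≈-refl
    Σ-ε (i ∷ F) h = ≈-trans
      (∙-cong (h i (here refl)) (Σ-ε F λ j j∈F → h j (there j∈F))) (identityˡ ε)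

    Σ-∙ : ∀ F (f g : I → Carrier) → Σ F (λ i → f i ∙ g i) ≈ Σ F f ∙ Σ F g
    Σ-∙ []      f g = ≈-sym (identityˡ ε)
    Σ-∙ (i ∷ F) f g = ≈-trans (∙-congˡ (Σ-∙ F f g)) (interchange _ _ _ _)

    Σ-++ : ∀ F G (f : I → Carrier) → Σ (F ++ G) f ≈ Σ F f ∙ Σ G f
    Σ-++ []      G f = ≈-sym (identityˡ _)
    Σ-++ (i ∷ F) G f = ≈-trans (∙-congˡ (Σ-++ F G f)) (≈-sym (assoc _ _ _))

    Σ-map : {J : Set} (h : J → I) (F : List J) (f : I → Carrier) → Σ (map h F) f ≈ Σ F (f ∘ h)
    Σ-map h []      f = ≈-refl
    Σ-map h (j ∷ F) f = ∙-congˡ (Σ-map h F f)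

    Σ-shift : ∀ F i G (f : I → Carrier) → Σ (F ++ i ∷ G) f ≈ f i ∙ Σ (F ++ G) f
    Σ-shift []      i G f = ≈-refl
    Σ-shift (j ∷ F) i G f = ≈-trans (∙-congˡ (Σ-shift F i G f)) (x∙yz≈y∙xz _ _ _)

    -- Induction on `F`: its head is moved to the front of `G` and split off from both sums.
    -- Uniqueness ensures that it does not recur in either remainder.
    Σ-⊆ : ∀ {F G} → Unique F → Unique G → F ⊆ G → (f : I → Carrier) →
      (∀ i → i ∈ G → i ∉ F → f i ≈ ε) → Σ G f ≈ Σ F f
    Σ-⊆ {[]} {G} _ _ _ f zero-off = Σ-ε G λ i i∈G → zero-off i i∈G λ ()
    Σ-⊆ {a ∷ F} (a∉F ∷ !F) !G F⊆G f zero-off with ∈-∃++ (F⊆G (here refl))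
    ... | G₁ , G₂ , refl with Permutation.Unique-resp-↭ (≡.setoid I) (↭⇒↭ₛ (shift a G₁ G₂)) !G
    ...   | a∉G ∷ !G′ = ≈-trans (Σ-shift G₁ a G₂ f) (∙-congˡ (Σ-⊆ !F !G′ F⊆G′ f
      λ i i∈G i∉F → zero-off i (∈-resp-↭ (↭-sym (shift a G₁ G₂)) (there i∈G))
        λ { (here refl) → All.lookup a∉G i∈G refl ; (there i∈F) → i∉F i∈F }))
      where
      F⊆G′ : F ⊆ G₁ ++ G₂
      F⊆G′ i∈F with ∈-resp-↭ (shift a G₁ G₂) (F⊆G (there i∈F))
      ... | here refl = contradiction refl (All.lookup a∉F i∈F)
      ... | there i∈G = i∈G

-- Real and complex numbers

∣p+q∣<ε : ∀ {ε} p q → ℚ.∣ p ∣ ℚ.< ½ ℚ.* ε → ℚ.∣ q ∣ ℚ.< ½ ℚ.* ε → ℚ.∣ p ℚ.+ q ∣ ℚ.< ε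
∣p+q∣<ε {ε} p q p<ε q<ε = begin-strict
  ℚ.∣ p ℚ.+ q ∣         ≤⟨ ℚ.∣p+q∣≤∣p∣+∣q∣ p q ⟩
  ℚ.∣ p ∣ ℚ.+ ℚ.∣ q ∣   <⟨ ℚ.+-mono-< p<ε q<ε ⟩
  ½ ℚ.* ε ℚ.+ ½ ℚ.* ε   ≡⟨ half+half ε ⟩
  ε                     ∎
  where open ℚ.≤-Reasoning

-- Termwise equality of the representing sequences. The algebraic laws hold already at this level,
-- where they are identities of rationals.
_≐ℝ_ : ℝ → ℝ → Set
x ≐ℝ y = ∀ n → seq x n ≡ seq y n

≐⇒≈ℝ : ∀ {x y} → x ≐ℝ y → x ≈ℝ y
≐⇒≈ℝ {x} {y} eq ε 0<ε = 0 , λ n _ → subst (λ r → ℚ.∣ r ∣ ℚ.< ε)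
  (trans (sym (ℚ.+-inverseʳ (seq y n))) (cong (ℚ._- seq y n) (sym (eq n)))) 0<ε

≈ℝ-sym : ∀ {x y} → x ≈ℝ y → y ≈ℝ x
≈ℝ-sym {x} {y} x≈y ε 0<ε with x≈y ε 0<ε
... | N , h = N , λ n N≤n → subst (ℚ._< ε) (∣-∣-sym (seq x n) (seq y n)) (h n N≤n)

eventually : {P Q : ℕ → Set} → (∀ n → P n → Q n) →
  (∃[ N ] ∀ n → N ℕ.≤ n → P n) → ∃[ N ] ∀ n → N ℕ.≤ n → Q n
eventually f (N , p) = N , λ n N≤n → f n (p n N≤n)

module _ {P Q R : ℕ → Set} (f : ∀ n → P n → Q n → R n) where

  eventually₂ : (∃[ N ] ∀ n → N ℕ.≤ n → P n) → (∃[ N ] ∀ n → N ℕ.≤ n → Q n) →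
    ∃[ N ] ∀ n → N ℕ.≤ n → R n
  eventually₂ (M , p) (N , q) = M ℕ.⊔ N , λ n M⊔N≤n →
    f n (p n (ℕ.m⊔n≤o⇒m≤o M N M⊔N≤n)) (q n (ℕ.m⊔n≤o⇒n≤o M N M⊔N≤n))

≈ℝ-trans : ∀ {x y z} → x ≈ℝ y → y ≈ℝ z → x ≈ℝ z
≈ℝ-trans {x} {y} {z} x≈y y≈z ε 0<ε = eventually₂
  (λ n p q → subst (λ r → ℚ.∣ r ∣ ℚ.< ε)
    (solve 3 (λ a b c → (a :- b) :+ (b :- c) := a :- c) refl (seq x n) (seq y n) (seq z n))
    (∣p+q∣<ε (seq x n ℚ.- seq y n) (seq y n ℚ.- seq z n) p q))
  (x≈y (½ ℚ.* ε) (half-pos 0<ε)) (y≈z (½ ℚ.* ε) (half-pos 0<ε))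

+ℝ-cong : ∀ {x y u v} → x ≈ℝ y → u ≈ℝ v → x +ℝ u ≈ℝ y +ℝ v
+ℝ-cong {x} {y} {u} {v} x≈y u≈v ε 0<ε = eventually₂
  (λ n p q → subst (λ r → ℚ.∣ r ∣ ℚ.< ε)
    (solve 4 (λ a b c d → (a :- b) :+ (c :- d) := (a :+ c) :- (b :+ d)) refl (seq x n) (seq y n) (seq u n) (seq v n))
    (∣p+q∣<ε (seq x n ℚ.- seq y n) (seq u n ℚ.- seq v n) p q))
  (x≈y (½ ℚ.* ε) (half-pos 0<ε)) (u≈v (½ ℚ.* ε) (half-pos 0<ε))

negℝ-cong : ∀ {x y} → x ≈ℝ y → negℝ x ≈ℝ negℝ y
negℝ-cong {x} {y} x≈y ε 0<ε with x≈y ε 0<ε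
... | N , h = N , λ n N≤n → subst (ℚ._< ε)
  (trans (∣-∣-sym (seq x n) (seq y n))
    (cong ℚ.∣_∣ (solve 2 (λ a b → b :- a := (:- a) :- (:- b)) refl (seq x n) (seq y n))))
  (h n N≤n)

ℝ-+-abelianGroup : AbelianGroup 0ℓ 0ℓ
ℝ-+-abelianGroup = record
  { Carrier = ℝ ; _≈_ = _≈ℝ_ ; _∙_ = _+ℝ_ ; ε = fromℚ 0ℚ ; _⁻¹ = negℝ
  ; isAbelianGroup = record
    { isGroup = record
      { isMonoid = record
        { isSemigroup = record
          { isMagma = record
            { isEquivalence = record
              { refl  = λ {x} → ≐⇒≈ℝ {x} {x} λ _ → refl
              ; sym   = λ {x} {y} → ≈ℝ-sym {x} {y}
              ; trans = λ {x} {y} {z} → ≈ℝ-trans {x} {y} {z}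
              }
            ; ∙-cong = λ {x} {y} {u} {v} → +ℝ-cong {x} {y} {u} {v}
            }
          ; assoc = λ x y z → ≐⇒≈ℝ {x +ℝ y +ℝ z} {x +ℝ (y +ℝ z)} λ n → ℚ.+-assoc (seq x n) (seq y n) (seq z n)
          }
        ; identity = (λ x → ≐⇒≈ℝ {fromℚ 0ℚ +ℝ x} {x} λ n → ℚ.+-identityˡ (seq x n))
                   , (λ x → ≐⇒≈ℝ {x +ℝ fromℚ 0ℚ} {x} λ n → ℚ.+-identityʳ (seq x n))
        }
      ; inverse = (λ x → ≐⇒≈ℝ {negℝ x +ℝ x} {fromℚ 0ℚ} λ n → ℚ.+-inverseˡ (seq x n))
                , (λ x → ≐⇒≈ℝ {x +ℝ negℝ x} {fromℚ 0ℚ} λ n → ℚ.+-inverseʳ (seq x n))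
      ; ⁻¹-cong = λ {x} {y} → negℝ-cong {x} {y}
      }
    ; comm = λ x y → ≐⇒≈ℝ {x +ℝ y} {y +ℝ x} λ n → ℚ.+-comm (seq x n) (seq y n)
    }
  }

module ℝ+ = AbelianGroup ℝ-+-abelianGroup

negℂ : ℂ → ℂ
negℂ z = negℝ (re z) +i negℝ (im z)

ℂ-+-abelianGroup : AbelianGroup 0ℓ 0ℓ
ℂ-+-abelianGroup = record
  { Carrier = ℂ ; _≈_ = _≈ℂ_ ; _∙_ = _+ℂ_ ; ε = 0ℂ ; _⁻¹ = negℂ
  ; isAbelianGroup = record
    { isGroup = record
      { isMonoid = record
        { isSemigroup = record
          { isMagma = record
            { isEquivalence = record
              { refl  = λ {z} → ℝ+.refl {re z} , ℝ+.refl {im z}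
              ; sym   = λ {z} {w} (p , q) → ≈ℝ-sym {re z} {re w} p , ≈ℝ-sym {im z} {im w} q
              ; trans = λ {z} {w} {t} (p , q) (r , s) →
                  ≈ℝ-trans {re z} {re w} {re t} p r , ≈ℝ-trans {im z} {im w} {im t} q s
              }
            ; ∙-cong = λ {z} {w} {t} {u} (p , q) (r , s) →
                +ℝ-cong {re z} {re w} {re t} {re u} p r , +ℝ-cong {im z} {im w} {im t} {im u} q s
            }
          ; assoc = λ z w t → ℝ+.assoc (re z) (re w) (re t) , ℝ+.assoc (im z) (im w) (im t)
          }
        ; identity = (λ z → ℝ+.identityˡ (re z) , ℝ+.identityˡ (im z))
                   , (λ z → ℝ+.identityʳ (re z) , ℝ+.identityʳ (im z))
        }
      ; inverse = (λ z → ℝ+.inverseˡ (re z) , ℝ+.inverseˡ (im z))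
                , (λ z → ℝ+.inverseʳ (re z) , ℝ+.inverseʳ (im z))
      ; ⁻¹-cong = λ {z} {w} (p , q) → negℝ-cong {re z} {re w} p , negℝ-cong {im z} {im w} q
      }
    ; comm = λ z w → ℝ+.comm (re z) (re w) , ℝ+.comm (im z) (im w)
    }
  }

module ℂ+ = AbelianGroup ℂ-+-abelianGroup
module ℂGroup = GroupProperties ℂ+.group
module ℝΣ = FiniteSums ℝ+.commutativeMonoid
module ℂΣ = FiniteSums ℂ+.commutativeMonoid

_≐ℂ_ : ℂ → ℂ → Set
z ≐ℂ w = re z ≐ℝ re w × im z ≐ℝ im w

≐⇒≈ℂ : ∀ {z w} → z ≐ℂ w → z ≈ℂ w
≐⇒≈ℂ {z} {w} (p , q) = ≐⇒≈ℝ {re z} {re w} p , ≐⇒≈ℝ {im z} {im w} q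

*ℂ-identityʳ : ∀ z → z *ℂ 1ℂ ≈ℂ z
*ℂ-identityʳ z = ≐⇒≈ℂ {z *ℂ 1ℂ} {z}
  ( (λ n → solve 2 (λ a b → a :* con 1ℚ :- b :* con 0ℚ := a) refl (seq (re z) n) (seq (im z) n))
  , (λ n → solve 2 (λ a b → a :* con 0ℚ :+ b :* con 1ℚ := b) refl (seq (re z) n) (seq (im z) n)))

*ℂ-identityˡ : ∀ z → 1ℂ *ℂ z ≈ℂ z
*ℂ-identityˡ z = ≐⇒≈ℂ {1ℂ *ℂ z} {z}
  ( (λ n → solve 2 (λ a b → con 1ℚ :* a :- con 0ℚ :* b := a) refl (seq (re z) n) (seq (im z) n))
  , (λ n → solve 2 (λ a b → con 1ℚ :* b :+ con 0ℚ :* a := b) refl (seq (re z) n) (seq (im z) n)))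

*ℂ-zeroʳ : ∀ z → z *ℂ 0ℂ ≈ℂ 0ℂ
*ℂ-zeroʳ z = ≐⇒≈ℂ {z *ℂ 0ℂ} {0ℂ}
  ( (λ n → solve 2 (λ a b → a :* con 0ℚ :- b :* con 0ℚ := con 0ℚ) refl (seq (re z) n) (seq (im z) n))
  , (λ n → solve 2 (λ a b → a :* con 0ℚ :+ b :* con 0ℚ := con 0ℚ) refl (seq (re z) n) (seq (im z) n)))

*ℂ-zeroˡ : ∀ z → 0ℂ *ℂ z ≈ℂ 0ℂ
*ℂ-zeroˡ z = ≐⇒≈ℂ {0ℂ *ℂ z} {0ℂ}
  ( (λ n → solve 2 (λ a b → con 0ℚ :* a :- con 0ℚ :* b := con 0ℚ) refl (seq (re z) n) (seq (im z) n))
  , (λ n → solve 2 (λ a b → con 0ℚ :* b :+ con 0ℚ :* a := con 0ℚ) refl (seq (re z) n) (seq (im z) n)))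

*ℂ-distribˡ : ∀ z w t → z *ℂ (w +ℂ t) ≈ℂ z *ℂ w +ℂ z *ℂ t
*ℂ-distribˡ z w t = ≐⇒≈ℂ {z *ℂ (w +ℂ t)} {z *ℂ w +ℂ z *ℂ t}
  ( (λ n → solve 6 (λ a b c d e f → a :* (c :+ e) :- b :* (d :+ f) := (a :* c :- b :* d) :+ (a :* e :- b :* f)) refl
      (seq (re z) n) (seq (im z) n) (seq (re w) n) (seq (im w) n) (seq (re t) n) (seq (im t) n))
  , (λ n → solve 6 (λ a b c d e f → a :* (d :+ f) :+ b :* (c :+ e) := (a :* d :+ b :* c) :+ (a :* f :+ b :* e)) refl
      (seq (re z) n) (seq (im z) n) (seq (re w) n) (seq (im w) n) (seq (re t) n) (seq (im t) n)))

*ℂ-distribʳ : ∀ z w t → (w +ℂ t) *ℂ z ≈ℂ w *ℂ z +ℂ t *ℂ z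
*ℂ-distribʳ z w t = ≐⇒≈ℂ {(w +ℂ t) *ℂ z} {w *ℂ z +ℂ t *ℂ z}
  ( (λ n → solve 6 (λ a b c d e f → (c :+ e) :* a :- (d :+ f) :* b := (c :* a :- d :* b) :+ (e :* a :- f :* b)) refl
      (seq (re z) n) (seq (im z) n) (seq (re w) n) (seq (im w) n) (seq (re t) n) (seq (im t) n))
  , (λ n → solve 6 (λ a b c d e f → (c :+ e) :* b :+ (d :+ f) :* a := (c :* b :+ d :* a) :+ (e :* b :+ f :* a)) refl
      (seq (re z) n) (seq (im z) n) (seq (re w) n) (seq (im w) n) (seq (re t) n) (seq (im t) n)))

-- The modulus compared with real and imaginary parts

square-cancel-≤ : ∀ {s t} → 0ℚ ℚ.≤ t → s ℚ.* s ℚ.≤ t ℚ.* t → s ℚ.≤ t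
square-cancel-≤ {s} {t} 0≤t s²≤t² with s ℚ.≤? t
... | yes s≤t = s≤t
... | no  s≰t = ⊥-elim (ℚ.<-irrefl refl (ℚ.<-≤-trans (ℚ.≤-<-trans
  (ℚ.*-monoˡ-≤-nonNeg t {{ℚ.nonNegative 0≤t}} (ℚ.<⇒≤ t<s))
  (ℚ.*-monoˡ-<-pos s {{ℚ.positive (ℚ.≤-<-trans 0≤t t<s)}} t<s)) s²≤t²))
  where
  t<s : t ℚ.< s
  t<s = ℚ.≰⇒> s≰t

∣p∣*∣p∣≡p*p : ∀ p → ℚ.∣ p ∣ ℚ.* ℚ.∣ p ∣ ≡ p ℚ.* p
∣p∣*∣p∣≡p*p p with ℚ.∣p∣≡p∨∣p∣≡-p p
... | inj₁ eq = cong₂ ℚ._*_ eq eq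
... | inj₂ eq = trans (cong₂ ℚ._*_ eq eq) (solve 1 (λ a → (:- a) :* (:- a) := a :* a) refl p)

0≤p*q : ∀ {p q} → 0ℚ ℚ.≤ p → 0ℚ ℚ.≤ q → 0ℚ ℚ.≤ p ℚ.* q
0≤p*q {p} {q} 0≤p 0≤q = subst (ℚ._≤ p ℚ.* q) (ℚ.*-zeroʳ p) (ℚ.*-monoˡ-≤-nonNeg p {{ℚ.nonNegative 0≤p}} 0≤q)

p≤p+q : ∀ {p q} → 0ℚ ℚ.≤ q → p ℚ.≤ p ℚ.+ q
p≤p+q {p} {q} 0≤q = subst (ℚ._≤ p ℚ.+ q) (ℚ.+-identityʳ p) (ℚ.+-monoʳ-≤ p 0≤q)

0≤p*p : ∀ p → 0ℚ ℚ.≤ p ℚ.* p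
0≤p*p p = subst (0ℚ ℚ.≤_) (∣p∣*∣p∣≡p*p p) (0≤p*q (ℚ.0≤∣p∣ p) (ℚ.0≤∣p∣ p))

sum-of-squares-≤ : ∀ {s t} → 0ℚ ℚ.≤ s → 0ℚ ℚ.≤ t → s ℚ.* s ℚ.+ t ℚ.* t ℚ.≤ (s ℚ.+ t) ℚ.* (s ℚ.+ t)
sum-of-squares-≤ {s} {t} 0≤s 0≤t = subst (s ℚ.* s ℚ.+ t ℚ.* t ℚ.≤_)
  (solve 2 (λ s t → (s :* s :+ t :* t) :+ (s :* t :+ s :* t) := (s :+ t) :* (s :+ t)) refl s t)
  (p≤p+q {s ℚ.* s ℚ.+ t ℚ.* t} {s ℚ.* t ℚ.+ s ℚ.* t} (ℚ.+-mono-≤ 0≤st 0≤st))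
  where
  0≤st : 0ℚ ℚ.≤ s ℚ.* t
  0≤st = 0≤p*q 0≤s 0≤t

-- `√ℚ` approximates the root from below, so its square is at most `a² + b²`, which is at most the
-- square of the right-hand side.
√ℚ-≤ : ∀ n a b → √ℚ n (a ℚ.* a ℚ.+ b ℚ.* b) ℚ.≤ ℚ.∣ a ∣ ℚ.+ ℚ.∣ b ∣
√ℚ-≤ n a b = square-cancel-≤ {√ℚ n q} {ℚ.∣ a ∣ ℚ.+ ℚ.∣ b ∣} (ℚ.+-mono-≤ (ℚ.0≤∣p∣ a) (ℚ.0≤∣p∣ b))
  (ℚ.≤-trans (√ℚ-lower n q) (subst (ℚ._≤ (ℚ.∣ a ∣ ℚ.+ ℚ.∣ b ∣) ℚ.* (ℚ.∣ a ∣ ℚ.+ ℚ.∣ b ∣))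
    (trans (cong₂ ℚ._+_ (∣p∣*∣p∣≡p*p a) (∣p∣*∣p∣≡p*p b))
      (sym (ℚ.0≤p⇒∣p∣≡p {q} (ℚ.+-mono-≤ (0≤p*p a) (0≤p*p b)))))
    (sum-of-squares-≤ (ℚ.0≤∣p∣ a) (ℚ.0≤∣p∣ b))))
  where
  q : ℚ
  q = a ℚ.* a ℚ.+ b ℚ.* b

-- The summand `1/(n+1)` compensates for the rounding down in `√ℚ`; with it the square exceeds
-- `a² + b²`.
∣re∣≤√ℚ : ∀ n a b → ℚ.∣ a ∣ ℚ.≤ √ℚ n (a ℚ.* a ℚ.+ b ℚ.* b) ℚ.+ + 1 ℚ./ suc n
∣re∣≤√ℚ n a b = square-cancel-≤ (ℚ.+-mono-≤ (√ℚ-nonNeg n q) (1/-nonNeg n)) (begin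
  ℚ.∣ a ∣ ℚ.* ℚ.∣ a ∣                                           ≡⟨ ∣p∣*∣p∣≡p*p a ⟩
  a ℚ.* a                                                       ≤⟨ p≤p+q (0≤p*p b) ⟩
  q                                                             ≤⟨ p≤∣p∣ q ⟩
  ℚ.∣ q ∣                                                       ≤⟨ ℚ.<⇒≤ (√ℚ-upper n q) ⟩
  (√ℚ n q ℚ.+ + 1 ℚ./ suc n) ℚ.* (√ℚ n q ℚ.+ + 1 ℚ./ suc n)     ∎)
  where
  open ℚ.≤-Reasoning
  q = a ℚ.* a ℚ.+ b ℚ.* b

∣im∣≤√ℚ : ∀ n a b → ℚ.∣ b ∣ ℚ.≤ √ℚ n (a ℚ.* a ℚ.+ b ℚ.* b) ℚ.+ + 1 ℚ./ suc n
∣im∣≤√ℚ n a b = subst (λ q → ℚ.∣ b ∣ ℚ.≤ √ℚ n q ℚ.+ + 1 ℚ./ suc n) (ℚ.+-comm (b ℚ.* b) (a ℚ.* a)) (∣re∣≤√ℚ n b a)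

∣∣ℂ-≤ : ∀ z n → seq ∣ z ∣ℂ n ℚ.≤ ℚ.∣ seq (re z) n ∣ ℚ.+ ℚ.∣ seq (im z) n ∣
∣∣ℂ-≤ z n = √ℚ-≤ n (seq (re z) n) (seq (im z) n)

x≈0⇒∣x∣<ε : ∀ x → x ≈ℝ fromℚ 0ℚ → ∀ ε → 0ℚ ℚ.< ε → ∃[ N ] ∀ n → N ℕ.≤ n → ℚ.∣ seq x n ∣ ℚ.< ε
x≈0⇒∣x∣<ε x x≈0 ε 0<ε = eventually
  (λ n → subst (λ r → ℚ.∣ r ∣ ℚ.< ε) (ℚ.+-identityʳ (seq x n))) (x≈0 ε 0<ε)

z≈0⇒∣z∣<ε : ∀ z → z ≈ℂ 0ℂ → ∀ ε → 0ℚ ℚ.< ε → ∃[ N ] ∀ n → N ℕ.≤ n → seq ∣ z ∣ℂ n ℚ.< ε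
z≈0⇒∣z∣<ε z (p , q) ε 0<ε = eventually₂
  (λ n a<ε b<ε → ℚ.≤-<-trans (∣∣ℂ-≤ z n) (subst (_ ℚ.<_) (half+half ε) (ℚ.+-mono-< a<ε b<ε)))
  (x≈0⇒∣x∣<ε (re z) p (½ ℚ.* ε) (half-pos 0<ε)) (x≈0⇒∣x∣<ε (im z) q (½ ℚ.* ε) (half-pos 0<ε))

<⇒≤+ : ∀ {p ε η} → 0ℚ ℚ.< η → p ℚ.< ε → p ℚ.≤ ε ℚ.+ η
<⇒≤+ {p} {ε} {η} 0<η p<ε = ℚ.≤-trans (ℚ.<⇒≤ p<ε) (p≤p+q {ε} {η} (ℚ.<⇒≤ 0<η))

z≈0⇒∣z∣≈0 : ∀ z → z ≈ℂ 0ℂ → ∣ z ∣ℂ ≈ℝ fromℚ 0ℚ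
z≈0⇒∣z∣≈0 z z≈0 ε 0<ε = eventually
  {λ n → seq ∣ z ∣ℂ n ℚ.< ε} {λ n → ℚ.∣ seq ∣ z ∣ℂ n ℚ.- 0ℚ ∣ ℚ.< ε}
  (λ n → subst (ℚ._< ε) (sym (trans (cong ℚ.∣_∣ (ℚ.+-identityʳ (seq ∣ z ∣ℂ n)))
    (ℚ.0≤p⇒∣p∣≡p {seq ∣ z ∣ℂ n} (√ℚ-nonNeg n (seq (re z *ℝ re z +ℝ im z *ℝ im z) n))))))
  (z≈0⇒∣z∣<ε z z≈0 ε 0<ε)

z≈w⇒∣z-w∣≤ε : ∀ {z w} → z ≈ℂ w → ∀ {ε} → 0ℚ ℚ.< ε → ∣ z -ℂ w ∣ℂ ≤ℝ fromℚ ε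
z≈w⇒∣z-w∣≤ε {z} {w} z≈w {ε} 0<ε η 0<η = eventually
  {λ n → seq ∣ z -ℂ w ∣ℂ n ℚ.< ε} {λ n → seq ∣ z -ℂ w ∣ℂ n ℚ.≤ ε ℚ.+ η}
  (λ n → <⇒≤+ {seq ∣ z -ℂ w ∣ℂ n} {ε} {η} 0<η)
  (z≈0⇒∣z∣<ε (z -ℂ w) (ℂGroup.x≈y⇒x∙y⁻¹≈ε {z} {w} z≈w) ε 0<ε)

x≈y⇒∣x-y∣≤ε : ∀ {x y} → x ≈ℝ y → ∀ {ε} → 0ℚ ℚ.< ε → absℝ (x -ℝ y) ≤ℝ fromℚ ε
x≈y⇒∣x-y∣≤ε {x} {y} x≈y {ε} 0<ε η 0<η = eventually
  {λ n → ℚ.∣ seq x n ℚ.- seq y n ∣ ℚ.< ε} {λ n → ℚ.∣ seq x n ℚ.- seq y n ∣ ℚ.≤ ε ℚ.+ η}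
  (λ n → <⇒≤+ {ℚ.∣ seq x n ℚ.- seq y n ∣} {ε} {η} 0<η) (x≈y ε 0<ε)

-- The error budget is half of `ε` for the distance from `x` to `y`, a quarter for `r n` and a
-- quarter for the rounding error `1/(n+1)`.
close-to-small : ∀ x y (r : ℕ → ℚ) {ε} → 0ℚ ℚ.< ε → x ≈ℝ y →
  (∀ n → ℚ.∣ seq y n ∣ ℚ.≤ r n ℚ.+ + 1 ℚ./ suc n) →
  (∃[ N ] ∀ n → N ℕ.≤ n → r n ℚ.≤ ½ ℚ.* (½ ℚ.* ε)) →
  ∃[ N ] ∀ n → N ℕ.≤ n → ℚ.∣ seq x n ℚ.- 0ℚ ∣ ℚ.< ε
close-to-small x y r {ε} 0<ε x≈y y≤r r≤ε = eventually₂
  (λ n p (q , s) → subst (λ t → ℚ.∣ t ∣ ℚ.< ε)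
    (solve 2 (λ a b → (a :- b) :+ b := a :- con 0ℚ) refl (seq x n) (seq y n))
    (∣p+q∣<ε (seq x n ℚ.- seq y n) (seq y n) p (ℚ.≤-<-trans (y≤r n)
      (subst (_ ℚ.<_) (half+half (½ ℚ.* ε)) (ℚ.+-mono-≤-< q s)))))
  (x≈y (½ ℚ.* ε) (half-pos 0<ε))
  (eventually₂ (λ _ → _,_) r≤ε (1/-small (half-pos (half-pos 0<ε))))

-- The representative `w` may vary with `ε`. It will be a partial sum minus a limit in one
-- application, and a matrix entry moved far out in its column in the other.
small⇒≈0 : ∀ z → (∀ ε → 0ℚ ℚ.< ε → ∃[ w ] z ≈ℂ w × ∣ w ∣ℂ ≤ℝ fromℚ ε) → z ≈ℂ 0ℂ
small⇒≈0 z h = (λ ε 0<ε → part₁ ε 0<ε) , (λ ε 0<ε → part₂ ε 0<ε)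
  where
  module _ (ε : ℚ) (0<ε : 0ℚ ℚ.< ε) where
    δ : ℚ
    -- An eighth of `ε`: the relation `≤ℝ` adds a slack of its own, also taken to be `δ`, and
    -- `δ + δ` is the quarter that `close-to-small` asks for.
    δ = ½ ℚ.* (½ ℚ.* (½ ℚ.* ε))
    0<δ : 0ℚ ℚ.< δ
    0<δ = half-pos (half-pos (half-pos 0<ε))
    w : ℂ
    w = proj₁ (h δ 0<δ)
    ∣w∣≤ : ∃[ N ] ∀ n → N ℕ.≤ n → seq ∣ w ∣ℂ n ℚ.≤ ½ ℚ.* (½ ℚ.* ε)
    ∣w∣≤ = eventually (λ n → subst (seq ∣ w ∣ℂ n ℚ.≤_) (half+half (½ ℚ.* (½ ℚ.* ε))))
      (proj₂ (proj₂ (h δ 0<δ)) δ 0<δ)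
    part₁ : ∃[ N ] ∀ n → N ℕ.≤ n → ℚ.∣ seq (re z) n ℚ.- 0ℚ ∣ ℚ.< ε
    part₁ = close-to-small (re z) (re w) (seq ∣ w ∣ℂ) 0<ε (proj₁ (proj₁ (proj₂ (h δ 0<δ))))
      (λ n → ∣re∣≤√ℚ n (seq (re w) n) (seq (im w) n)) ∣w∣≤
    part₂ : ∃[ N ] ∀ n → N ℕ.≤ n → ℚ.∣ seq (im z) n ℚ.- 0ℚ ∣ ℚ.< ε
    part₂ = close-to-small (im z) (im w) (seq ∣ w ∣ℂ) 0<ε (proj₂ (proj₁ (proj₂ (h δ 0<δ))))
      (λ n → ∣im∣≤√ℚ n (seq (re w) n) (seq (im w) n)) ∣w∣≤

∣∣₁-triangle : ∀ a b c d →
  ℚ.∣ a ℚ.+ b ∣ ℚ.+ ℚ.∣ c ℚ.+ d ∣ ℚ.≤ (ℚ.∣ a ∣ ℚ.+ ℚ.∣ c ∣) ℚ.+ (ℚ.∣ b ∣ ℚ.+ ℚ.∣ d ∣)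
∣∣₁-triangle a b c d = subst (ℚ.∣ a ℚ.+ b ∣ ℚ.+ ℚ.∣ c ℚ.+ d ∣ ℚ.≤_)
  (solve 4 (λ a b c d → (a :+ b) :+ (c :+ d) := (a :+ c) :+ (b :+ d)) refl ℚ.∣ a ∣ ℚ.∣ b ∣ ℚ.∣ c ∣ ℚ.∣ d ∣)
  (ℚ.+-mono-≤ (ℚ.∣p+q∣≤∣p∣+∣q∣ a b) (ℚ.∣p+q∣≤∣p∣+∣q∣ c d))

-- Only the lengths of the two lists are compared, so their index types may differ: `F` will be the
-- support of a column and `G` the terms of a formal sum.
Σℝ-mono : {I J : Set} (f : I → ℝ) (b : ℝ) (n : ℕ) → 0ℚ ℚ.≤ seq b n → (∀ i → seq (f i) n ℚ.≤ seq b n) →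
  ∀ (F : List I) (G : List J) → length F ℕ.≤ length G → seq (Σℝ F f) n ℚ.≤ seq (Σℝ G (λ _ → b)) n
Σℝ-mono f b n 0≤b f≤b []      []      _ = ℚ.≤-refl
Σℝ-mono f b n 0≤b f≤b []      (_ ∷ G) _ = ℚ.+-mono-≤ 0≤b (Σℝ-mono f b n 0≤b f≤b [] G ℕ.z≤n)
Σℝ-mono f b n 0≤b f≤b (i ∷ F) (_ ∷ G) (ℕ.s≤s h) = ℚ.+-mono-≤ (f≤b i) (Σℝ-mono f b n 0≤b f≤b F G h)

-- Sums with finite support

-- The form of `HasSumℂ` in which the partial sums become equal to the limit. All matrix products
-- computed below converge in this way.
HasFiniteSum : {I : Set} → (I → ℂ) → ℂ → Set
HasFiniteSum {I} f s = ∃[ F ] ∀ (G : List I) → Unique G → F ⊆ G → Σℂ G f ≈ℂ s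

module _ {I : Set} where

  hasFiniteSum⇒hasSum : ∀ {f : I → ℂ} {s} → HasFiniteSum f s → HasSumℂ f s
  hasFiniteSum⇒hasSum {f} {s} (F , h) ε 0<ε = F , λ G !G F⊆G →
    z≈w⇒∣z-w∣≤ε {Σℂ G f} {s} (h G !G F⊆G) 0<ε

  hasFiniteSum-+ : ∀ {f g : I → ℂ} {s t} → HasFiniteSum f s → HasFiniteSum g t →
    HasFiniteSum (λ i → f i +ℂ g i) (s +ℂ t)
  hasFiniteSum-+ {f} {g} {s} {t} (F , p) (F′ , q) = F ++ F′ , λ G !G ⊆G →
    ℂ+.trans {Σℂ G (λ i → f i +ℂ g i)} {Σℂ G f +ℂ Σℂ G g} {s +ℂ t} (ℂΣ.Σ-∙ G f g)
      (ℂ+.∙-cong {Σℂ G f} {s} {Σℂ G g} {t} (p G !G (λ i∈ → ⊆G (∈-++⁺ˡ i∈))) (q G !G (λ i∈ → ⊆G (∈-++⁺ʳ F i∈))))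

  hasFiniteSum-cong : ∀ {f g : I → ℂ} {s t} → (∀ i → f i ≈ℂ g i) → s ≈ℂ t →
    HasFiniteSum f s → HasFiniteSum g t
  hasFiniteSum-cong {f} {g} {s} {t} f≈g s≈t (F , h) = F , λ G !G F⊆G →
    ℂ+.trans {Σℂ G g} {Σℂ G f} {t} (ℂ+.sym {Σℂ G f} {Σℂ G g} (ℂΣ.Σ-cong G {f} {g} λ i _ → f≈g i))
      (ℂ+.trans {Σℂ G f} {s} {t} (h G !G F⊆G) s≈t)

  hasFiniteSum-0 : HasFiniteSum {I} (λ _ → 0ℂ) 0ℂ
  hasFiniteSum-0 = [] , λ G _ _ → ℂΣ.Σ-ε G {λ _ → 0ℂ} λ _ _ → ℂ+.refl {0ℂ}

  hasFiniteSum-single : ∀ (f : I → ℂ) a {s} → f a ≈ℂ s → (∀ i → i ∉ a ∷ [] → f i ≈ℂ 0ℂ) → HasFiniteSum f s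
  hasFiniteSum-single f a {s} fa≈s h = a ∷ [] , λ G !G ⊆G →
    ℂ+.trans {Σℂ G f} {Σℂ (a ∷ []) f} {s}
      (ℂΣ.Σ-⊆ (All.[] ∷ []) !G ⊆G f λ i _ → h i)
      (ℂ+.trans {f a +ℂ 0ℂ} {f a} {s} (ℂ+.identityʳ (f a)) fa≈s)

module _ {I : Set} (_≟_ : DecidableEquality I) where

  open DecUnique _≟_ using (deduplicate-!)

  -- A finite set that is large enough for both hypotheses has a sum equal to `s` and within `ε` of
  -- `t`.
  hasSum-unique : ∀ {f : I → ℂ} {s t} → HasFiniteSum f s → HasSumℂ f t → s ≈ℂ t
  hasSum-unique {f} {s} {t} (F , h) sum = ℂGroup.x∙y⁻¹≈ε⇒x≈y s t (small⇒≈0 (s -ℂ t) λ ε 0<ε → near ε 0<ε)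
    where
    near : ∀ ε → 0ℚ ℚ.< ε → ∃[ w ] s -ℂ t ≈ℂ w × ∣ w ∣ℂ ≤ℝ fromℚ ε
    near ε 0<ε with sum ε 0<ε
    ... | F′ , b = Σℂ G f -ℂ t
      , ℂ+.∙-congʳ {negℂ t} {s} {Σℂ G f} (ℂ+.sym {Σℂ G f} {s}
          (h G !G λ i∈ → ∈-deduplicate⁺ _≟_ (∈-++⁺ˡ i∈)))
      , b G !G λ i∈ → ∈-deduplicate⁺ _≟_ (∈-++⁺ʳ F i∈)
      where
      G : List I
      G = deduplicate _≟_ (F ++ F′)
      !G : Unique G
      !G = deduplicate-! (F ++ F′)

  -- A term outside F is the difference of the partial sums over F ∪ {i}
  -- and F.
  hasSumℝ⇒small-terms : ∀ {f : I → ℝ} {s} → HasSumℝ f s → ∀ ε → 0ℚ ℚ.< ε →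
    ∃[ F ] ∀ i → i ∉ F → f i ≤ℝ fromℚ ε
  hasSumℝ⇒small-terms {f} {s} sum ε 0<ε with sum (½ ℚ.* ε) (half-pos 0<ε)
  ... | F , b = F , λ i i∉F → term i i∉F
    where
    G : List I
    G = deduplicate _≟_ F
    F⊆G : F ⊆ G
    F⊆G = ∈-deduplicate⁺ _≟_
    !G : Unique G
    !G = deduplicate-! F
    term : ∀ i → i ∉ F → f i ≤ℝ fromℚ ε
    term i i∉F η 0<η = eventually₂ (λ n p q → begin
      seq (f i) n                        ≡⟨ solve 3 (λ a b c → a := ((a :+ b) :- c) :- (b :- c)) refl (seq (f i) n) (seq (Σℝ G f) n) (seq s n) ⟩
      u n ℚ.- v n                        ≤⟨ p≤∣p∣ (u n ℚ.- v n) ⟩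
      ℚ.∣ u n ℚ.- v n ∣                  ≤⟨ ℚ.∣p-q∣≤∣p∣+∣q∣ (u n) (v n) ⟩
      ℚ.∣ u n ∣ ℚ.+ ℚ.∣ v n ∣            ≤⟨ ℚ.+-mono-≤ p q ⟩
      (½ ℚ.* ε ℚ.+ ½ ℚ.* η) ℚ.+ (½ ℚ.* ε ℚ.+ ½ ℚ.* η)
        ≡⟨ solve 2 (λ a b → (con ½ :* a :+ con ½ :* b) :+ (con ½ :* a :+ con ½ :* b) := a :+ b) refl ε η ⟩
      ε ℚ.+ η                            ∎)
      (b (i ∷ G) (All.tabulate (λ { i∈G refl → i∉F (∈-deduplicate⁻ _≟_ F i∈G) }) ∷ !G) (λ i∈ → there (F⊆G i∈)) (½ ℚ.* η) (half-pos 0<η))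
      (b G !G F⊆G (½ ℚ.* η) (half-pos 0<η))
      where
      open ℚ.≤-Reasoning
      u v : ℕ → ℚ
      u n = (seq (f i) n ℚ.+ seq (Σℝ G f) n) ℚ.- seq s n
      v n = seq (Σℝ G f) n ℚ.- seq s n

-- Formal sums over a finite poset

module FormalSums (K : AbelianGroup 0ℓ 0ℓ) (D : DecSetoid 0ℓ 0ℓ) where

  open AbelianGroup K using (_≈_; _∙_; ε; _⁻¹; ∙-cong; ∙-congˡ; identityˡ; identityʳ)
    renaming (Carrier to Scalar; refl to ≈-refl; sym to ≈-sym; trans to ≈-trans; reflexive to ≈-reflexive)
  open GroupProperties (AbelianGroup.group K) using (∙-cancelʳ; //-rightDividesˡ)
  open DecSetoid D using (_≟_) renaming (Carrier to X; _≈_ to _≋_; refl to ≋-refl; sym to ≋-sym; trans to ≋-trans)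
  open FiniteSums (AbelianGroup.commutativeMonoid K) public

  when : Bool → Scalar → Scalar
  when b c = if b then c else ε

  when-cong : ∀ {b b′ c c′} → b ≡ b′ → (b ≡ true → c ≈ c′) → when b c ≈ when b′ c′
  when-cong {true}  refl h = h refl
  when-cong {false} refl h = ≈-refl

  when-ε : ∀ b → when b ε ≈ ε
  when-ε true  = ≈-refl
  when-ε false = ≈-refl

  when-∙ : ∀ b c c′ → when b (c ∙ c′) ≈ when b c ∙ when b c′
  when-∙ true  c c′ = ≈-refl
  when-∙ false c c′ = ≈-sym (identityˡ ε)

  -- The linear functional extending the 0-1 function `P`. Coefficients, values of combinations of
  -- the `m⟨ π ⟩`, matrix entries and sums over lower sets are all of this form.
  evaluate : List (Scalar × X) → (X → Bool) → Scalar
  evaluate x P = Σ x (λ (c , e) → when (P e) c)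

  -- Over `ℂ` this unfolds to `coefficient`, so equality of all `coeff` is `SameSum`.
  coeff : List (Scalar × X) → X → Scalar
  coeff x d = evaluate x (λ e → does (e ≟ d))

  evaluate-≗ : ∀ x {P Q} → (∀ e → P e ≡ Q e) → evaluate x P ≈ evaluate x Q
  evaluate-≗ x h = Σ-cong x λ (c , e) _ → when-cong (h e) λ _ → ≈-refl

  Respects : (X → Bool) → Set
  Respects P = ∀ {d e} → d ≋ e → P d ≡ P e

  module Enumeration (list : List X) (complete : ∀ d → SetoidMembership._∈_ (DecSetoid.setoid D) d list) where

    open SetoidMembership (DecSetoid.setoid D) using () renaming (_∈_ to _∈ₛ_)

    -- One representative of each class of the setoid.
    elements : List X
    elements = deduplicate _≟_ list

    ∈-elements : ∀ d → d ∈ₛ elements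
    ∈-elements d = SetoidMembershipₚ.∈-deduplicate⁺ (DecSetoid.setoid D) _≟_
      (λ z≈y x≈y → ≋-trans x≈y (≋-sym z≈y)) (complete d)

    Σ-select-unique : ∀ {E a} c → AllPairs (λ d e → ¬ d ≋ e) E → a ∈ₛ E →
      Σ E (λ e → when (does (a ≟ e)) c) ≈ c
    Σ-select-unique {e ∷ E} {a} c (e∉E ∷ !E) a∈E with a ≟ e
    Σ-select-unique {e ∷ E} {a} c (e∉E ∷ !E) a∈E | yes a≈e = ≈-trans
      (∙-congˡ (Σ-ε E λ e′ e′∈E → ≈-reflexive (≡.cong (λ b → when b c)
        (dec-false (a ≟ e′) λ a≈e′ → All.lookup e∉E e′∈E (≋-trans (≋-sym a≈e) a≈e′)))))
      (identityʳ c)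
    Σ-select-unique {e ∷ E} {a} c (e∉E ∷ !E) (here a≈e)  | no a≉e = contradiction a≈e a≉e
    Σ-select-unique {e ∷ E} {a} c (e∉E ∷ !E) (there a∈E) | no a≉e =
      ≈-trans (identityˡ _) (Σ-select-unique c !E a∈E)

    Σ-select : ∀ a c → Σ elements (λ e → when (does (a ≟ e)) c) ≈ c
    Σ-select a c = Σ-select-unique c (DecSetoidUnique.deduplicate-! D list) (∈-elements a)

    -- This collects like terms. A term at `a` contributes to the coefficient of exactly one
    -- representative `e`, and `P` takes the same value at `e` as at `a`.
    evaluate-expand : ∀ x {P} → Respects P → evaluate x P ≈ Σ elements (λ e → when (P e) (coeff x e))
    evaluate-expand []            {P} P-resp = ≈-sym (Σ-ε elements λ e _ → when-ε (P e))
    evaluate-expand ((c , a) ∷ x) {P} P-resp = ≈-sym (≈-trans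
      (Σ-cong elements λ e _ → when-∙ (P e) _ _) (≈-trans
      (Σ-∙ elements (λ e → when (P e) (when (does (a ≟ e)) c)) (λ e → when (P e) (coeff x e)))
      (∙-cong (≈-trans (Σ-cong elements λ e _ → reorder e) (Σ-select a _)) (≈-sym (evaluate-expand x P-resp)))))
      where
      reorder : ∀ e → when (P e) (when (does (a ≟ e)) c) ≈ when (does (a ≟ e)) (when (P a) c)
      reorder e with a ≟ e
      ... | yes a≈e = when-cong (≡.sym (P-resp a≈e)) λ _ → ≈-refl
      ... | no  a≉e = when-ε (P e)

    -- Coefficients are compared only where `P` holds, so an induction on rank can apply this with
    -- `P` cutting out the elements already treated.
    evaluate-cong : ∀ x y {P} → Respects P → (∀ e → P e ≡ true → coeff x e ≈ coeff y e) →
      evaluate x P ≈ evaluate y P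
    evaluate-cong x y P-resp h = ≈-trans (evaluate-expand x P-resp) (≈-trans
      (Σ-cong elements λ e _ → when-cong refl (h e)) (≈-sym (evaluate-expand y P-resp)))

    module Order
      {_⊑_ : Rel X 0ℓ} (_⊑?_ : Decidable _⊑_)
      (⊑-reflexive : ∀ {d e} → d ≋ e → d ⊑ e) (⊑-trans : Transitive _⊑_)
      (rank : X → ℕ) (rank-mono : ∀ {d e} → d ⊑ e → rank d ℕ.≤ rank e)
      (rank-strict : ∀ {d e} → d ⊑ e → rank e ℕ.≤ rank d → d ≋ e)
      where

      -- The zeta transform of the coefficient function for the order `⊑`.
      sumBelow : List (Scalar × X) → X → Scalar
      sumBelow x d = evaluate x (λ e → does (e ⊑? d))

      sumBelow-cong : ∀ x {d e} → d ≋ e → sumBelow x d ≈ sumBelow x e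
      sumBelow-cong x d≈e = evaluate-≗ x λ a → does-⇔
        (mk⇔ (λ a⊑d → ⊑-trans a⊑d (⊑-reflexive d≈e)) (λ a⊑e → ⊑-trans a⊑e (⊑-reflexive (≋-sym d≈e)))) (a ⊑? _) (a ⊑? _)

      strictlyBelow : X → X → Bool
      strictlyBelow d e = does (e ⊑? d) ∧ not (does (e ≟ d))

      strictlyBelow-respects : ∀ d → Respects (strictlyBelow d)
      strictlyBelow-respects d {a} {b} a≈b = ≡.cong₂ (λ p q → p ∧ not q)
        (does-⇔ (mk⇔ (⊑-trans (⊑-reflexive (≋-sym a≈b))) (⊑-trans (⊑-reflexive a≈b))) (a ⊑? d) (b ⊑? d))
        (does-⇔ (mk⇔ (≋-trans (≋-sym a≈b)) (≋-trans a≈b)) (a ≟ d) (b ≟ d))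

      strictlyBelow⇒rank< : ∀ d e → strictlyBelow d e ≡ true → rank e ℕ.< rank d
      strictlyBelow⇒rank< d e eq with e ⊑? d | e ≟ d
      strictlyBelow⇒rank< d e () | yes e⊑d | yes _
      strictlyBelow⇒rank< d e _  | yes e⊑d | no e≉d = ℕ.≰⇒> λ d≤e → e≉d (rank-strict e⊑d d≤e)

      sumBelow-split : ∀ x d → sumBelow x d ≈ coeff x d ∙ evaluate x (strictlyBelow d)
      sumBelow-split x d = ≈-trans (Σ-cong x λ (c , e) _ → split c e)
        (Σ-∙ x (λ (c , e) → when (does (e ≟ d)) c) (λ (c , e) → when (strictlyBelow d e) c))
        where
        split : ∀ c e → when (does (e ⊑? d)) c ≈ when (does (e ≟ d)) c ∙ when (strictlyBelow d e) c
        split c e with e ⊑? d | e ≟ d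
        ... | yes _   | yes _   = ≈-sym (identityʳ c)
        ... | yes _   | no  _   = ≈-sym (identityˡ c)
        ... | no  _   | no  _   = ≈-sym (identityˡ ε)
        ... | no  e⋢d | yes e≈d = contradiction (⊑-reflexive e≈d) e⋢d

      -- The zeta transform is unitriangular: `sumBelow x d` is `coeff x d` plus coefficients of
      -- smaller rank, which agree by induction and cancel.
      sumBelow-injective : ∀ x y → (∀ d → sumBelow x d ≈ sumBelow y d) → ∀ d → coeff x d ≈ coeff y d
      sumBelow-injective x y h d = go (suc (rank d)) d ℕ.≤-refl
        where
        go : ∀ n d → rank d ℕ.< n → coeff x d ≈ coeff y d
        go (suc n) d (ℕ.s≤s d≤n) = ∙-cancelʳ (evaluate x (strictlyBelow d)) _ _
          (≈-trans (≈-sym (sumBelow-split x d)) (≈-trans (h d) (≈-trans (sumBelow-split y d)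
            (∙-congˡ (evaluate-cong y x (strictlyBelow-respects d) λ e e⊏d →
              ≈-sym (go n e (ℕ.<-≤-trans (strictlyBelow⇒rank< d e e⊏d) d≤n)))))))

      module _ (v : X → Scalar) (v-cong : ∀ {d e} → d ≋ e → v d ≈ v e) where

        -- Möbius inversion, one rank at a time.
        sumBelow-surjective-< : ∀ n → ∃[ x ] ∀ d → rank d ℕ.< n → sumBelow x d ≈ v d
        sumBelow-surjective-< zero    = [] , λ _ ()
        sumBelow-surjective-< (suc n) with sumBelow-surjective-< n
        -- Each element of rank `n` receives its own defect as an extra coefficient. Nothing of rank
        -- `n` lies below an element of smaller rank, and below one of rank `n` only the element
        -- itself has that rank, so no other value of rank at most `n` is disturbed.
        ... | x , correct = x ++ map (λ e → correction e , e) elements , λ d d≤n → ≈-trans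
          (Σ-++ x _ _) (≈-trans (∙-congˡ (Σ-map (λ e → correction e , e) elements _)) (fixed d (ℕ.m≤n⇒m<n∨m≡n (ℕ.≤-pred d≤n))))
          where
          defect : X → Scalar
          defect e = v e ∙ sumBelow x e ⁻¹

          correction : X → Scalar
          correction e = when (does (rank e ℕ.≟ n)) (defect e)

          lowRank : ∀ d → rank d ℕ.< n → ∀ e → when (does (e ⊑? d)) (correction e) ≈ ε
          lowRank d d<n e with e ⊑? d
          ... | no  _   = ≈-refl
          ... | yes e⊑d = ≈-reflexive (≡.cong (λ b → when b (defect e))
            (dec-false (rank e ℕ.≟ n) (ℕ.<⇒≢ (ℕ.≤-<-trans (rank-mono e⊑d) d<n))))

          sameRank : ∀ d → rank d ≡ n → ∀ e → when (does (e ⊑? d)) (correction e) ≈ when (does (d ≟ e)) (defect d)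
          sameRank d refl e with d ≟ e
          ... | yes d≈e = ≈-trans
            (≈-reflexive (≡.cong₂ (λ b b′ → when b (when b′ (defect e)))
              (dec-true (e ⊑? d) (⊑-reflexive (≋-sym d≈e)))
              (dec-true (rank e ℕ.≟ n) (ℕ.≤-antisym (rank-mono (⊑-reflexive (≋-sym d≈e))) (rank-mono (⊑-reflexive d≈e))))))
            (∙-cong (v-cong (≋-sym d≈e)) (AbelianGroup.⁻¹-cong K (sumBelow-cong x (≋-sym d≈e))))
          ... | no  d≉e with e ⊑? d
          ...   | no  _   = ≈-refl
          ...   | yes e⊑d = ≈-reflexive (≡.cong (λ b → when b (defect e))
            (dec-false (rank e ℕ.≟ n) λ e≡n → d≉e (≋-sym (rank-strict e⊑d (ℕ.≤-reflexive (≡.sym e≡n))))))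

          fixed : ∀ d → rank d ℕ.< n ⊎ rank d ≡ n →
            sumBelow x d ∙ Σ elements (λ e → when (does (e ⊑? d)) (correction e)) ≈ v d
          fixed d (inj₁ d<n) = ≈-trans (∙-congˡ (Σ-ε elements λ e _ → lowRank d d<n e))
            (≈-trans (identityʳ _) (correct d d<n))
          fixed d (inj₂ d≡n) = ≈-trans
            (∙-congˡ (≈-trans (Σ-cong elements λ e _ → sameRank d d≡n e) (Σ-select d (defect d))))
            (≈-trans (AbelianGroup.comm K _ _) (//-rightDividesˡ (sumBelow x d) (v d)))

        sumBelow-surjective : ∀ {N} → (∀ d → rank d ℕ.< N) → ∃[ x ] ∀ d → sumBelow x d ≈ v d
        sumBelow-surjective {N} bound with sumBelow-surjective-< N
        ... | x , correct = x , λ d → correct d (bound d)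

-- Partitions of a finite set

module _ {A : Set} where

  count : (A → Bool) → List A → ℕ
  count p []       = 0
  count p (a ∷ as) = (if p a then 1 else 0) ℕ.+ count p as

  count-≤-length : ∀ p as → count p as ℕ.≤ length as
  count-≤-length p []       = ℕ.z≤n
  count-≤-length p (a ∷ as) with p a
  ... | true  = ℕ.s≤s (count-≤-length p as)
  ... | false = ℕ.m≤n⇒m≤1+n (count-≤-length p as)

  module _ {p q : A → Bool} (p⇒q : ∀ a → T (p a) → T (q a)) where

    count-mono : ∀ as → count p as ℕ.≤ count q as
    count-mono []       = ℕ.z≤n
    count-mono (a ∷ as) with p a | q a | p⇒q a
    ... | true  | true  | _ = ℕ.s≤s (count-mono as)
    ... | true  | false | h = ⊥-elim (h tt)
    ... | false | true  | _ = ℕ.m≤n⇒m≤1+n (count-mono as)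
    ... | false | false | _ = count-mono as

    -- A member of the list satisfying `q` but not `p` would make the count of `q` strictly larger.
    count-strict : ∀ {as} → count q as ℕ.≤ count p as → ∀ {a} → a ∈ as → p a ≡ q a
    count-strict {b ∷ as} q≤p a∈as with p b in pb | q b in qb | p⇒q b
    count-strict {b ∷ as} q≤p _ | true | false | h = ⊥-elim (h tt)
    count-strict {b ∷ as} q≤p _ | false | true | _ = contradiction (count-mono as) (ℕ.<⇒≱ q≤p)
    count-strict {b ∷ as} q≤p (here refl)  | true  | true  | _ = trans pb (sym qb)
    count-strict {b ∷ as} q≤p (there a∈as) | true  | true  | _ = count-strict (ℕ.≤-pred q≤p) a∈as
    count-strict {b ∷ as} q≤p (here refl)  | false | false | _ = trans pb (sym qb)
    count-strict {b ∷ as} q≤p (there a∈as) | false | false | _ = count-strict q≤p a∈as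

  firstIndex : (A → Bool) → List A → ℕ
  firstIndex p []       = 0
  firstIndex p (a ∷ as) = if p a then 0 else suc (firstIndex p as)

  firstIndex-cong : ∀ {p q} → (∀ a → p a ≡ q a) → ∀ as → firstIndex p as ≡ firstIndex q as
  firstIndex-cong h []       = refl
  firstIndex-cong {p} {q} h (a ∷ as) with p a | q a | h a
  ... | true  | _ | refl = refl
  ... | false | _ | refl = cong suc (firstIndex-cong h as)

  firstIndex-≤-length : ∀ p as → firstIndex p as ℕ.≤ length as
  firstIndex-≤-length p []       = ℕ.z≤n
  firstIndex-≤-length p (a ∷ as) with p a
  ... | true  = ℕ.z≤n
  ... | false = ℕ.s≤s (firstIndex-≤-length p as)

  -- The element at the common position satisfies both predicates. Both must occur in the list,
  -- since `firstIndex` returns the length of the list when there is no hit.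
  firstIndex-common : ∀ p q {as} → Any (T ∘ p) as → Any (T ∘ q) as →
    firstIndex p as ≡ firstIndex q as → ∃[ a ] T (p a) × T (q a)
  firstIndex-common p q {a ∷ as} ps qs eq with p a in pa | q a in qa
  ... | true  | true  = a , subst T (sym pa) tt , subst T (sym qa) tt
  firstIndex-common p q {a ∷ as} ps qs () | true | false
  firstIndex-common p q {a ∷ as} ps qs () | false | true
  firstIndex-common p q {a ∷ as} (here pa′)  qs          eq | false | false = ⊥-elim (subst T pa pa′)
  firstIndex-common p q {a ∷ as} (there ps) (here qa′)  eq | false | false = ⊥-elim (subst T qa qa′)
  firstIndex-common p q {a ∷ as} (there ps) (there qs)  eq | false | false =
    firstIndex-common p q ps qs (ℕ.suc-injective eq)

module _ {X : Set} where

  kernel : (X → ℕ) → SetPartition X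
  kernel f = record
    { sameBlock = λ x y → does (f x ℕ.≟ f y)
    ; isEquivalence = record
      { refl  = λ {x} → T-does⁺ (f x ℕ.≟ f x) refl
      ; sym   = λ {x} {y} p → T-does⁺ (f y ℕ.≟ f x) (sym (T-does⁻ (f x ℕ.≟ f y) p))
      ; trans = λ {x} {y} {z} p q → T-does⁺ (f x ℕ.≟ f z)
                  (trans (T-does⁻ (f x ℕ.≟ f y) p) (T-does⁻ (f y ℕ.≟ f z) q))
      }
    }

  Finer : SetPartition X → SetPartition X → Set
  Finer π ρ = ∀ x y → _∼_ π x y → _∼_ ρ x y

  finer-reflexive : ∀ π ρ → SamePartition π ρ → Finer π ρ
  finer-reflexive π ρ eq x y = subst T (eq x y)

  ConstantOn : SetPartition X → (X → ℕ) → Set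
  ConstantOn π f = ∀ x y → _∼_ π x y → f x ≡ f y

  constantOn⇒finer : ∀ π f → ConstantOn π f → Finer π (kernel f)
  constantOn⇒finer π f h x y p = T-does⁺ (f x ℕ.≟ f y) (h x y p)

  finer⇒constantOn : ∀ π f → Finer π (kernel f) → ConstantOn π f
  finer⇒constantOn π f h x y p = T-does⁻ (f x ℕ.≟ f y) (h x y p)

module FinitePartitions {X : Set} (_≟_ : DecidableEquality X)
  (xs : List X) (∈-xs : ∀ x → x ∈ xs) (every? : Exhaustible X) where

  -- A canonical name for the block of `x`: the position of its first member in `xs`.
  label : SetPartition X → X → ℕ
  label π x = firstIndex (sameBlock π x) xs

  label-≡ : ∀ π {x y} → _∼_ π x y → label π x ≡ label π y
  label-≡ π {x} {y} x∼y = firstIndex-cong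
    (λ z → does-⇔ (mk⇔ (∼-trans π (∼-sym π x∼y)) (∼-trans π x∼y)) (T? (sameBlock π x z)) (T? (sameBlock π y z))) xs

  label-∼ : ∀ π {x y} → label π x ≡ label π y → _∼_ π x y
  label-∼ π {x} {y} eq with firstIndex-common (sameBlock π x) (sameBlock π y)
    (Any.map (λ { refl → ∼-refl π }) (∈-xs x)) (Any.map (λ { refl → ∼-refl π }) (∈-xs y)) eq
  ... | z , x∼z , y∼z = ∼-trans π x∼z (∼-sym π y∼z)

  kernel-label : ∀ π → SamePartition (kernel (label π)) π
  kernel-label π x y = does-⇔ (mk⇔ (label-∼ π) (label-≡ π)) (label π x ℕ.≟ label π y) (T? (sameBlock π x y))

  label-cong : ∀ π ρ → SamePartition π ρ → ∀ x → label π x ≡ label ρ x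
  label-cong π ρ eq x = firstIndex-cong (eq x) xs

  -- Represents every function with values below `n` up to agreement on the given list; outside that
  -- list the value is 0.
  functions : ℕ → List X → List (X → ℕ)
  functions n []       = (λ _ → 0) ∷ []
  functions n (y ∷ ys) = cartesianProductWith (λ v f x → if does (x ≟ y) then v else f x) (upTo n) (functions n ys)

  functions-complete : ∀ {n} (g : X → ℕ) → (∀ x → g x ℕ.< n) → ∀ ys →
    ∃[ f ] f ∈ functions n ys × (∀ x → x ∈ ys → f x ≡ g x)
  functions-complete g g<n []       = _ , here refl , λ _ ()
  functions-complete g g<n (y ∷ ys) with functions-complete g g<n ys
  ... | f , f∈ , f≡g = _ , ∈-cartesianProductWith⁺ _ (∈-upTo⁺ (g<n y)) f∈ , agree
    where
    agree : ∀ x → x ∈ y ∷ ys → (if does (x ≟ y) then g y else f x) ≡ g x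
    agree x x∈ with x ≟ y
    agree x x∈           | yes refl = refl
    agree x (here x≡y)   | no x≢y   = contradiction x≡y x≢y
    agree x (there x∈ys) | no x≢y   = f≡g x x∈ys

  -- Complete because every partition is the kernel of its own `label`, whose values are at most
  -- `length xs`.
  partitions : List (SetPartition X)
  partitions = map kernel (functions (suc (length xs)) xs)

  partitions-complete : ∀ π → Any (SamePartition π) partitions
  partitions-complete π with functions-complete (label π) (λ x → ℕ.s≤s (firstIndex-≤-length (sameBlock π x) xs)) xs
  ... | f , f∈ , f≡ = Any.map (λ { refl x y → trans (sym (kernel-label π x y)) (same x y) }) (∈-map⁺ kernel f∈)
    where
    same : ∀ x y → does (label π x ℕ.≟ label π y) ≡ does (f x ℕ.≟ f y)
    same x y rewrite f≡ x (∈-xs x) | f≡ y (∈-xs y) = refl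

  finer? : Decidable Finer
  finer? π ρ = every? λ x → every? λ y → T? (sameBlock π x y) →-dec T? (sameBlock ρ x y)

  pairs : List (X × X)
  pairs = cartesianProduct xs xs

  -- The number of related pairs, which strictly increases under proper coarsening.
  rank : SetPartition X → ℕ
  rank π = count (uncurry (sameBlock π)) pairs

  rank-mono : ∀ π ρ → Finer π ρ → rank π ℕ.≤ rank ρ
  rank-mono π ρ π≤ρ = count-mono (uncurry π≤ρ) pairs

  rank-strict : ∀ π ρ → Finer π ρ → rank ρ ℕ.≤ rank π → SamePartition π ρ
  rank-strict π ρ π≤ρ ρ≤π x y = count-strict (uncurry π≤ρ) ρ≤π (∈-cartesianProduct⁺ (∈-xs x) (∈-xs y))

  rank-bounded : ∀ π → rank π ℕ.< suc (length pairs)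
  rank-bounded π = ℕ.s≤s (count-≤-length (uncurry (sameBlock π)) pairs)

-- Finitary permutations of ℕ

swap : ℕ → ℕ → ℕ → ℕ
swap a b n = if does (n ℕ.≟ a) then b else if does (n ℕ.≟ b) then a else n

swap-left : ∀ a b → swap a b a ≡ b
swap-left a b rewrite dec-true (a ℕ.≟ a) refl = refl

swap-fixed : ∀ a b n → ¬ n ≡ a → ¬ n ≡ b → swap a b n ≡ n
swap-fixed a b n n≢a n≢b rewrite dec-false (n ℕ.≟ a) n≢a | dec-false (n ℕ.≟ b) n≢b = refl

swap-right : ∀ a b → swap a b b ≡ a
swap-right a b with b ℕ.≟ a
... | yes refl = swap-left a b
... | no  b≢a rewrite dec-false (b ℕ.≟ a) b≢a | dec-true (b ℕ.≟ b) refl = refl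

swap-trivial : ∀ a n → swap a a n ≡ n
swap-trivial a n with n ℕ.≟ a
... | yes refl = swap-left a a
... | no  n≢a  = swap-fixed a a n n≢a n≢a

swap-involutive : ∀ a b n → swap a b (swap a b n) ≡ n
swap-involutive a b n with n ℕ.≟ a | n ℕ.≟ b
... | yes refl | _        = trans (cong (swap n b) (swap-left n b)) (swap-right n b)
... | no  _    | yes refl = trans (cong (swap a n) (swap-right a n)) (swap-left a n)
... | no  n≢a  | no  n≢b  = trans (cong (swap a b) (swap-fixed a b n n≢a n≢b)) (swap-fixed a b n n≢a n≢b)

transposition : ℕ → ℕ → S∞
transposition a b = record
  { permutation = mk↔ₛ′ (swap a b) (swap a b) (swap-involutive a b) (swap-involutive a b)
  ; support = a ∷ b ∷ []
  ; fixes-outside = λ n n∉ → swap-fixed a b n (λ n≡a → n∉ (here n≡a)) (λ n≡b → n∉ (there (here n≡b)))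
  }

idS : S∞
idS = record
  { permutation = mk↔ₛ′ (λ n → n) (λ n → n) (λ _ → refl) (λ _ → refl)
  ; support = []
  ; fixes-outside = λ _ _ → refl
  }

to∘from : ∀ σ n → S∞.to σ (S∞.from σ n) ≡ n
to∘from σ = Inverse.strictlyInverseˡ (S∞.permutation σ)

from∘to : ∀ σ n → S∞.from σ (S∞.to σ n) ≡ n
from∘to σ = Inverse.strictlyInverseʳ (S∞.permutation σ)

to-injective : ∀ σ {m n} → S∞.to σ m ≡ S∞.to σ n → m ≡ n
to-injective σ {m} {n} eq = trans (sym (from∘to σ m)) (trans (cong (S∞.from σ) eq) (from∘to σ n))

from-injective : ∀ σ {m n} → S∞.from σ m ≡ S∞.from σ n → m ≡ n
from-injective σ {m} {n} eq = trans (sym (to∘from σ m)) (trans (cong (S∞.to σ) eq) (to∘from σ n))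

_∘S_ : S∞ → S∞ → S∞
τ ∘S σ = record
  { permutation = mk↔ₛ′ (S∞.to τ ∘ S∞.to σ) (S∞.from σ ∘ S∞.from τ)
      (λ n → trans (cong (S∞.to τ) (to∘from σ _)) (to∘from τ n))
      (λ n → trans (cong (S∞.from σ) (from∘to τ _)) (from∘to σ n))
  ; support = S∞.support σ ++ S∞.support τ
  ; fixes-outside = λ n n∉ → trans
      (cong (S∞.to τ) (S∞.fixes-outside σ n (λ n∈ → n∉ (∈-++⁺ˡ n∈))))
      (S∞.fixes-outside τ n (λ n∈ → n∉ (∈-++⁺ʳ (S∞.support σ) n∈)))
  }

-- Labels are matched one at a time: if σ (f x) = g x holds already for
-- the other x, then swapping σ (f x₀) with g x₀ preserves this, because
-- f and g have the same coincidences.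
permutation-extending : {X : Set} (f g : X → ℕ) →
  (∀ x y → f x ≡ f y → g x ≡ g y) → (∀ x y → g x ≡ g y → f x ≡ f y) →
  ∀ xs → ∃[ σ ] ∀ x → x ∈ xs → S∞.to σ (f x) ≡ g x
permutation-extending f g f⇒g g⇒f []        = idS , λ _ ()
permutation-extending f g f⇒g g⇒f (x₀ ∷ xs) with permutation-extending f g f⇒g g⇒f xs
... | σ , h = transposition a b ∘S σ , λ
    { x (here refl)  → swap-left a b
    ; x (there x∈xs) → trans (cong (swap a b) (h x x∈xs)) (fixed x (h x x∈xs))
    }
  where
  a b : ℕ
  a = S∞.to σ (f x₀)
  b = g x₀
  fixed : ∀ x → S∞.to σ (f x) ≡ g x → swap a b (g x) ≡ g x
  fixed x hx with g x ℕ.≟ b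
  ... | yes gx≡b = subst (λ c → swap a c (g x) ≡ g x) a≡b (swap-trivial a (g x))
    where
    a≡b : a ≡ b
    a≡b = trans (cong (S∞.to σ) (g⇒f x₀ x (sym gx≡b))) (trans hx gx≡b)
  ... | no gx≢b = swap-fixed a b (g x)
    (λ gx≡a → gx≢b (f⇒g x x₀ (to-injective σ (trans hx gx≡a)))) gx≢b

-- Indicator values and permuted indices

module ≈ℂ-Reasoning = SetoidReasoning ℂ+.setoid

*ℂ-indicator : ∀ c b → c *ℂ (if b then 1ℂ else 0ℂ) ≈ℂ (if b then c else 0ℂ)
*ℂ-indicator c true  = *ℂ-identityʳ c
*ℂ-indicator c false = *ℂ-zeroʳ c

≡⇒≈ℂ : ∀ z w → z ≡ w → z ≈ℂ w
≡⇒≈ℂ z w = ℂ+.reflexive {z} {w}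

∣indicator∣≤1 : ∀ b → ∣ if b then 1ℂ else 0ℂ ∣ℂ ≤ℝ fromℚ 1ℚ
∣indicator∣≤1 b ε 0<ε = 0 , λ n _ → ℚ.≤-trans (bound b n) (p≤p+q {1ℚ} {ε} (ℚ.<⇒≤ 0<ε))
  where
  bound : ∀ b n → seq ∣ if b then 1ℂ else 0ℂ ∣ℂ n ℚ.≤ 1ℚ
  bound true  n = ∣∣ℂ-≤ 1ℂ n
  bound false n = ℚ.≤-trans (∣∣ℂ-≤ 0ℂ n) (ℚ.<⇒≤ (ℚ.positive⁻¹ 1ℚ))

map-from∘to : ∀ {k} σ (i : Index k) → Vec.map (S∞.from σ) (Vec.map (S∞.to σ) i) ≡ i
map-from∘to σ i = trans (sym (Vec.map-∘ (S∞.from σ) (S∞.to σ) i))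
  (trans (Vec.map-cong (from∘to σ) i) (Vec.map-id i))

map-to∘from : ∀ {k} σ (i : Index k) → Vec.map (S∞.to σ) (Vec.map (S∞.from σ) i) ≡ i
map-to∘from σ i = trans (sym (Vec.map-∘ (S∞.to σ) (S∞.from σ) i))
  (trans (Vec.map-cong (to∘from σ) i) (Vec.map-id i))

-- Invariant functions

module Invariants (k : ℕ) where

  open FinitePartitions (_≟ᶠ_ {k}) (allFin k) ∈-allFin all?
  open FormalSums ℂ-+-abelianGroup (Partitions k)
  open Enumeration partitions partitions-complete
  open Order finer? (λ {π} {ρ} → finer-reflexive π ρ) (λ p q x y → q x y ∘ p x y)
    rank (λ {π} {ρ} → rank-mono π ρ) (λ {π} {ρ} → rank-strict π ρ)

  -- The chosen representative of the orbit of indices with kernel `ρ`.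
  index : SetPartition (Fin k) → Index k
  index ρ = tabulate (label ρ)

  linearCombination≈evaluate : ∀ x i →
    linearCombination x m⟨_⟩ i ≈ℂ evaluate x (λ π → does (constantOnBlocks? π i))
  linearCombination≈evaluate x i = ℂΣ.Σ-cong x
    {λ (c , π) → c *ℂ m⟨ π ⟩ i} {λ (c , π) → when (does (constantOnBlocks? π i)) c}
    λ (c , π) _ → *ℂ-indicator c (does (constantOnBlocks? π i))

  constant⇔finer : ∀ π i → does (constantOnBlocks? π i) ≡ does (finer? π (kernel (lookup i)))
  constant⇔finer π i = does-⇔ (mk⇔ (constantOn⇒finer π (lookup i)) (finer⇒constantOn π (lookup i)))
    (constantOnBlocks? π i) (finer? π (kernel (lookup i)))

  -- Turns evaluation of a combination of the `m⟨ π ⟩` at orbit representatives into the zeta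
  -- transform of its coefficients.
  constant-index⇔finer : ∀ π ρ → does (constantOnBlocks? π (index ρ)) ≡ does (finer? π ρ)
  constant-index⇔finer π ρ = does-⇔ (mk⇔
      (λ h x y p → label-∼ ρ (trans (sym (lookup-index x)) (trans (h x y p) (lookup-index y))))
      (λ h x y p → trans (lookup-index x) (trans (label-≡ ρ (h x y p)) (sym (lookup-index y)))))
    (constantOnBlocks? π (index ρ)) (finer? π ρ)
    where
    lookup-index : ∀ x → lookup (index ρ) x ≡ label ρ x
    lookup-index = Vec.lookup∘tabulate (label ρ)

  m-invariant : ∀ π → Invariant {k} m⟨ π ⟩
  m-invariant π σ i = ≡⇒≈ℂ (m⟨ π ⟩ (Vec.map (S∞.from σ) i)) (m⟨ π ⟩ i) (cong (λ b → if b then 1ℂ else 0ℂ) (does-⇔ (mk⇔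
      (λ h l m p → from-injective σ (trans (sym (at l)) (trans (h l m p) (at m))))
      (λ h l m p → trans (at l) (trans (cong (S∞.from σ) (h l m p)) (sym (at m)))))
    (constantOnBlocks? π (Vec.map (S∞.from σ) i)) (constantOnBlocks? π i)))
    where
    at : ∀ l → lookup (Vec.map (S∞.from σ) i) l ≡ S∞.from σ (lookup i l)
    at l = Vec.lookup-map l (S∞.from σ) i

  index-in-orbit : ∀ i → ∃[ σ ] Vec.map (S∞.to σ) i ≡ index (kernel (lookup i))
  index-in-orbit i with permutation-extending (lookup i) (label (kernel (lookup i)))
    (λ x y eq → label-≡ (kernel (lookup i)) (T-does⁺ (lookup i x ℕ.≟ lookup i y) eq))
    (λ x y eq → T-does⁻ (lookup i x ℕ.≟ lookup i y) (label-∼ (kernel (lookup i)) eq)) (allFin k)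
  ... | σ , h = σ , trans (sym (Vec.tabulate∘lookup _))
    (Vec.tabulate-cong λ l → trans (Vec.lookup-map l (S∞.to σ) i) (h l (∈-allFin l)))

  invariant-on-orbit : ∀ v → Invariant v → ∀ i → v (index (kernel (lookup i))) ≈ℂ v i
  invariant-on-orbit v inv i = begin
    v j                            ≈⟨ inv σ j ⟨
    v (Vec.map (S∞.from σ) j)      ≡⟨ cong (v ∘ Vec.map (S∞.from σ)) (sym eq) ⟩
    v (Vec.map (S∞.from σ) (Vec.map (S∞.to σ) i)) ≡⟨ cong v (map-from∘to σ i) ⟩
    v i                            ∎
    where
    open ≈ℂ-Reasoning
    j = index (kernel (lookup i))
    σ = proj₁ (index-in-orbit i)
    eq : Vec.map (S∞.to σ) i ≡ j
    eq = proj₂ (index-in-orbit i)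

  m-spanning : ∀ v → Invariant v → ∃[ x ] v ≈ᶠ linearCombination x m⟨_⟩
  m-spanning v inv = proj₁ solution , λ i → begin
    v i                                     ≈⟨ invariant-on-orbit v inv i ⟨
    v (index (kernel (lookup i)))           ≈⟨ proj₂ solution (kernel (lookup i)) ⟨
    sumBelow x (kernel (lookup i))          ≈⟨ evaluate-≗ x {fits i} {λ π → does (finer? π (kernel (lookup i)))} (λ π → constant⇔finer π i) ⟨
    evaluate x (fits i)                     ≈⟨ linearCombination≈evaluate x i ⟨
    linearCombination x m⟨_⟩ i              ∎
    where
    open ≈ℂ-Reasoning
    solution : ∃[ x ] ∀ π → sumBelow x π ≈ℂ v (index π)
    -- The coefficients come from Möbius inversion of the values of `v` at the orbit
    -- representatives; invariance then gives the values everywhere else.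
    solution = sumBelow-surjective (v ∘ index) (λ {π} {ρ} eq →
      ≡⇒≈ℂ (v (index π)) (v (index ρ)) (cong v (Vec.tabulate-cong (label-cong π ρ eq)))) rank-bounded
    x = proj₁ solution
    fits : Index k → SetPartition (Fin k) → Bool
    fits i π = does (constantOnBlocks? π i)

  m-independent : ∀ x → linearCombination x m⟨_⟩ ≈ᶠ (λ _ → 0ℂ) → SameSum (Partitions k) x []
  m-independent x h = sumBelow-injective x [] λ ρ → begin
    sumBelow x ρ                            ≈⟨ evaluate-≗ x {fits ρ} {λ π → does (finer? π ρ)} (λ π → constant-index⇔finer π ρ) ⟨
    evaluate x (fits ρ)                     ≈⟨ linearCombination≈evaluate x (index ρ) ⟨
    linearCombination x m⟨_⟩ (index ρ)      ≈⟨ h (index ρ) ⟩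
    0ℂ                                      ∎
    where
    open ≈ℂ-Reasoning
    fits : SetPartition (Fin k) → SetPartition (Fin k) → Bool
    fits ρ π = does (constantOnBlocks? π (index ρ))

  isBasis : IsBasis (ℓ∞-Invariants k) (Partitions k) m⟨_⟩
  isBasis = record
    { member      = λ π → (fromℚ 1ℚ , λ i → ∣indicator∣≤1 (does (constantOnBlocks? π i))) , m-invariant π
    ; spanning    = λ v (_ , inv) → m-spanning v inv
    ; independent = m-independent
    }

-- Diagrams

module _ {k : ℕ} where

  -- Each block of `e` contains a block of `d`, which already reaches the top row.
  bottomPropagating-coarser : ∀ {d e : Diagram k} → Finer d e → BottomPropagating d → BottomPropagating e
  bottomPropagating-coarser d≤e bp x h = bp x λ y x∼y → h y (d≤e x y x∼y)

  isBottom? : ∀ (x : Vertex k) → Dec (IsBottom x)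
  isBottom? (top _)    = no λ ()
  isBottom? (bottom _) = yes tt

  bottomPropagating? : ∀ d → Dec (BottomPropagating {k} d)
  bottomPropagating? d = everyVertex? λ x → ¬? (everyVertex? λ y → T? (sameBlock d x y) →-dec isBottom? y)

  selectBP : List (Diagram k) → List (BPDiagram k)
  selectBP []       = []
  selectBP (e ∷ es) with bottomPropagating? e
  ... | yes bp = record { diagram = e ; bottomPropagating = bp } ∷ selectBP es
  ... | no  _  = selectBP es

  selectBP-complete : ∀ (d : BPDiagram k) {es} → Any (SamePartition (diagram d)) es →
    Any (λ e → SamePartition (diagram d) (diagram e)) (selectBP es)
  selectBP-complete d {e ∷ es} d∈ with bottomPropagating? e
  selectBP-complete d {e ∷ es} (here d≈e) | yes _  = here d≈e
  selectBP-complete d {e ∷ es} (there d∈) | yes _  = there (selectBP-complete d d∈)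
  selectBP-complete d {e ∷ es} (here d≈e) | no ¬bp =
    ⊥-elim (¬bp (bottomPropagating-coarser {diagram d} {e} (finer-reflexive (diagram d) e d≈e) (bottomPropagating d)))
  selectBP-complete d {e ∷ es} (there d∈) | no _   = selectBP-complete d d∈

  -- The lower index i labels the bottom row and the upper index j the top
  -- row; with this choice matrix products stack like diagrams.
  labels : Index k → Index k → Vertex k → ℕ
  labels i j (top l)    = lookup j l
  labels i j (bottom l) = lookup i l

  Fits : Diagram k → Index k → Index k → Set
  Fits d i j = ConstantOn d (labels i j)

  fits? : ∀ d i j → Dec (Fits d i j)
  fits? d i j = everyVertex? λ x → everyVertex? λ y →
    T? (sameBlock d x y) →-dec (labels i j x ℕ.≟ labels i j y)

  fits-finer : ∀ {d e i j} → Finer d e → Fits e i j → Fits d i j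
  fits-finer d≤e h x y x∼y = h x y (d≤e x y x∼y)

  fits-identity⁺ : ∀ {i j} → i ≡ j → Fits identityDiagram i j
  fits-identity⁺ {i} refl x y x∼y = trans (at x)
    (trans (cong (lookup i) (T-does⁻ (column x ≟ᶠ column y) x∼y)) (sym (at y)))
    where
    at : ∀ x → labels i i x ≡ lookup i (column x)
    at (top _)    = refl
    at (bottom _) = refl

  lookup-injective : ∀ {i j : Index k} → (∀ l → lookup i l ≡ lookup j l) → i ≡ j
  lookup-injective {i} {j} h =
    trans (sym (Vec.tabulate∘lookup i)) (trans (Vec.tabulate-cong h) (Vec.tabulate∘lookup j))

  fits-identity⁻ : ∀ {i j} → Fits identityDiagram i j → i ≡ j
  fits-identity⁻ h = lookup-injective λ l → h (bottom l) (top l) (T-does⁺ (l ≟ᶠ l) refl)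

  labels-map : ∀ f i j x → labels (Vec.map f i) (Vec.map f j) x ≡ f (labels i j x)
  labels-map f i j (top l)    = Vec.lookup-map l f j
  labels-map f i j (bottom l) = Vec.lookup-map l f i

  fits-map : ∀ {d} f {i j} → Fits d i j → Fits d (Vec.map f i) (Vec.map f j)
  fits-map f {i} {j} h x y x∼y =
    trans (labels-map f i j x) (trans (cong f (h x y x∼y)) (sym (labels-map f i j y)))

  module _ (d : BPDiagram k) where

    topPartner : ∀ m → ∃[ t ] _∼_ (diagram d) (bottom m) (top t)
    topPartner m with any? (λ t → T? (sameBlock (diagram d) (bottom m) (top t)))
    ... | yes found = found
    ... | no  none  = ⊥-elim (bottomPropagating d (bottom m) λ
      { (top t) m∼t → ⊥-elim (none (t , m∼t)) ; (bottom _) _ → tt })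

    lowerIndex : Index k → Index k
    lowerIndex j = tabulate (λ m → lookup j (proj₁ (topPartner m)))

    lookup-lowerIndex : ∀ j m → lookup (lowerIndex j) m ≡ lookup j (proj₁ (topPartner m))
    lookup-lowerIndex j = Vec.lookup∘tabulate _

    -- Each bottom vertex shares a block with a top vertex and must carry its label. Hence a column
    -- of the matrix of `d` has at most one nonzero entry.
    fits⇒lowerIndex : ∀ {i j} → Fits (diagram d) i j → i ≡ lowerIndex j
    fits⇒lowerIndex {i} {j} h = lookup-injective λ m →
      trans (h (bottom m) (top _) (proj₂ (topPartner m))) (sym (lookup-lowerIndex j m))

  stackedLabels : Index k → Index k → Index k → StackedVertex k → ℕ
  stackedLabels i j l (upper m)  = lookup l m
  stackedLabels i j l (middle m) = lookup j m
  stackedLabels i j l (lower m)  = lookup i m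

  stackedLabels-above : ∀ i j l x → stackedLabels i j l (placeAbove x) ≡ labels j l x
  stackedLabels-above i j l (top _)    = refl
  stackedLabels-above i j l (bottom _) = refl

  stackedLabels-below : ∀ i j l x → stackedLabels i j l (placeBelow x) ≡ labels i j x
  stackedLabels-below i j l (top _)    = refl
  stackedLabels-below i j l (bottom _) = refl

  stackedLabels-outer : ∀ i j l x → stackedLabels i j l (outer x) ≡ labels i l x
  stackedLabels-outer i j l (top _)    = refl
  stackedLabels-outer i j l (bottom _) = refl

  -- The combined labelling of the three rows is constant along every edge, hence on connected
  -- components.
  fits-∗⁺ : ∀ d e {i j l} → Fits d j l → Fits e i j → Fits (d ∗ e) i l
  fits-∗⁺ d e {i} {j} {l} fd fe x y x∼y = trans (sym (stackedLabels-outer i j l x)) (trans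
    (Eq.gfold ≡.isEquivalence (stackedLabels i j l) constant (T-does⁻ (connected? d e (outer x) (outer y)) x∼y))
    (stackedLabels-outer i j l y))
    where
    constant : ∀ {u v} → Edge d e u v → stackedLabels i j l u ≡ stackedLabels i j l v
    constant (above {x} {y} p) = trans (stackedLabels-above i j l x) (trans (fd x y p) (sym (stackedLabels-above i j l y)))
    constant (below {x} {y} p) = trans (stackedLabels-below i j l x) (trans (fe x y p) (sym (stackedLabels-below i j l y)))

  -- Every middle vertex is joined to a top vertex, so a labelling of the
  -- outer rows determines that of the middle row.
  module _ (d : BPDiagram k) (e : Diagram k) {i l : Index k} (fits : Fits (diagram d ∗ e) i l) where

    private
      j : Index k
      j = lowerIndex d l

      exit : StackedVertex k → Vertex k
      exit (upper m)  = top m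
      exit (middle m) = top (proj₁ (topPartner d m))
      exit (lower m)  = bottom m

      exit-connected : ∀ u → Connected (diagram d) e u (outer (exit u))
      exit-connected (upper m)  = stop
      exit-connected (middle m) = fwd (above {x = bottom m} {y = top _} (proj₂ (topPartner d m))) ◅ stop
      exit-connected (lower m)  = stop

      exit-label : ∀ u → stackedLabels i j l u ≡ labels i l (exit u)
      exit-label (upper m)  = refl
      exit-label (middle m) = lookup-lowerIndex d l m
      exit-label (lower m)  = refl

      constant : ∀ {u v} → Edge (diagram d) e u v → stackedLabels i j l u ≡ stackedLabels i j l v
      constant {u} {v} uv = trans (exit-label u) (trans
        (fits (exit u) (exit v) (T-does⁺ (connected? (diagram d) e (outer (exit u)) (outer (exit v)))
          (Eq.symmetric _ (exit-connected u) ◅◅ (fwd uv ◅ exit-connected v))))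
        (sym (exit-label v)))

    fits-∗⁻ˡ : Fits (diagram d) j l
    fits-∗⁻ˡ x y x∼y = trans (sym (stackedLabels-above i j l x))
      (trans (constant (above x∼y)) (stackedLabels-above i j l y))

    fits-∗⁻ʳ : Fits e i j
    fits-∗⁻ʳ x y x∼y = trans (sym (stackedLabels-below i j l x))
      (trans (constant (below x∼y)) (stackedLabels-below i j l y))

-- Matrices of permutations

indicator-self : ∀ {k} (i : Index k) {j} → i ≡ j → indicator i j ≡ 1ℂ
indicator-self i {j} i≡j = cong (λ b → if b then 1ℂ else 0ℂ) (dec-true (i ≟ⁱ j) i≡j)

indicator-other : ∀ {k} (i : Index k) {j} → ¬ i ≡ j → indicator i j ≡ 0ℂ
indicator-other i {j} i≢j = cong (λ b → if b then 1ℂ else 0ℂ) (dec-false (i ≟ⁱ j) i≢j)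

module _ {k : ℕ} (σ : S∞) (A : Matrix k) where

  open ≈ℂ-Reasoning

  -- `permutationMatrix σ j l` unfolds to `indicator j l′`, so only the term with `j` equal to `l′`
  -- survives.
  permutationMatrix-productˡ : ∀ i l →
    HasFiniteSum (λ j → permutationMatrix σ j l *ℂ A i j) (A i (Vec.map (S∞.from σ) l))
  permutationMatrix-productˡ i l = hasFiniteSum-single f l′ {A i l′} (begin
      indicator l′ l′ *ℂ A i l′   ≡⟨ cong (_*ℂ A i l′) (indicator-self l′ refl) ⟩
      1ℂ *ℂ A i l′                ≈⟨ *ℂ-identityˡ (A i l′) ⟩
      A i l′                      ∎)
    (λ j j∉ → begin
      indicator j l′ *ℂ A i j     ≡⟨ cong (_*ℂ A i j) (indicator-other j (j∉ ∘ here)) ⟩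
      0ℂ *ℂ A i j                 ≈⟨ *ℂ-zeroˡ (A i j) ⟩
      0ℂ                          ∎)
    where
    l′ : Index k
    l′ = Vec.map (S∞.from σ) l
    f : Index k → ℂ
    f j = permutationMatrix σ j l *ℂ A i j

  permutationMatrix-productʳ : ∀ i l →
    HasFiniteSum (λ j → A j l *ℂ permutationMatrix σ i j) (A (Vec.map (S∞.to σ) i) l)
  permutationMatrix-productʳ i l = hasFiniteSum-single f i′ {A i′ l} (begin
      A i′ l *ℂ indicator i (Vec.map (S∞.from σ) i′)
        ≡⟨ cong (A i′ l *ℂ_) (indicator-self i (sym (map-from∘to σ i))) ⟩
      A i′ l *ℂ 1ℂ                ≈⟨ *ℂ-identityʳ (A i′ l) ⟩
      A i′ l                      ∎)
    (λ j j∉ → begin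
      A j l *ℂ indicator i (Vec.map (S∞.from σ) j)
        ≡⟨ cong (A j l *ℂ_) (indicator-other i λ i≡ → j∉ (here (trans (sym (map-to∘from σ j)) (cong (Vec.map (S∞.to σ)) (sym i≡))))) ⟩
      A j l *ℂ 0ℂ                 ≈⟨ *ℂ-zeroʳ (A j l) ⟩
      0ℂ                          ∎)
    where
    i′ : Index k
    i′ = Vec.map (S∞.to σ) i
    f : Index k → ℂ
    f j = A j l *ℂ permutationMatrix σ i j

  -- The entry of `C` at `i` and `j′` is computed from both products. Each is a sum with one
  -- possibly nonzero term, and these two terms are the two sides.
  commute⇒equivariant : Commute (permutationMatrix σ) A →
    ∀ i j → A i j ≈ℂ A (Vec.map (S∞.to σ) i) (Vec.map (S∞.to σ) j)
  commute⇒equivariant (C , left , right) i j = begin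
    A i j                              ≡⟨ cong (A i) (map-from∘to σ j) ⟨
    A i (Vec.map (S∞.from σ) j′)       ≈⟨ hasSum-unique _≟ⁱ_ {λ m → permutationMatrix σ m j′ *ℂ A i m} {A i (Vec.map (S∞.from σ) j′)} {C i j′}
                                            (permutationMatrix-productˡ i j′) (left i j′) ⟩
    C i j′                             ≈⟨ hasSum-unique _≟ⁱ_ {λ m → A m j′ *ℂ permutationMatrix σ i m} {A (Vec.map (S∞.to σ) i) j′} {C i j′}
                                            (permutationMatrix-productʳ i j′) (right i j′) ⟨
    A (Vec.map (S∞.to σ) i) j′         ∎
    where
    j′ : Index k
    j′ = Vec.map (S∞.to σ) j

  equivariant⇒commute : (∀ i j → A i j ≈ℂ A (Vec.map (S∞.to σ) i) (Vec.map (S∞.to σ) j)) →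
    Commute (permutationMatrix σ) A
  equivariant⇒commute equiv = (λ i l → A i (Vec.map (S∞.from σ) l))
    , (λ i l → hasFiniteSum⇒hasSum {f = λ j → permutationMatrix σ j l *ℂ A i j} {A i (Vec.map (S∞.from σ) l)}
        (permutationMatrix-productˡ i l))
    , (λ i l → let f = λ j → A j l *ℂ permutationMatrix σ i j in
        hasFiniteSum⇒hasSum {f = f} {A i (Vec.map (S∞.from σ) l)}
        (hasFiniteSum-cong {f = f} {f} {A (Vec.map (S∞.to σ) i) l} {A i (Vec.map (S∞.from σ) l)} (λ j → ℂ+.refl {f j}) (begin
          A (Vec.map (S∞.to σ) i) l    ≡⟨ cong (A (Vec.map (S∞.to σ) i)) (map-to∘from σ l) ⟨
          A (Vec.map (S∞.to σ) i) (Vec.map (S∞.to σ) (Vec.map (S∞.from σ) l))  ≈⟨ equiv i (Vec.map (S∞.from σ) l) ⟨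
          A i (Vec.map (S∞.from σ) l)  ∎)
        (permutationMatrix-productʳ i l)))

-- If some entry of i does not occur in j, then moving it to fresh values
-- yields infinitely many entries of the column j equal to A i j.
module _ {k : ℕ} {A : Matrix k} (central : Centralizer k A) where

  private
    entries : List (Index k) → List ℕ
    entries = concatMap Vec.toList

    fresh : List (Index k) → ℕ
    fresh F = suc (max 0 (entries F))

    fresh-∉ : ∀ F {i} l → i ∈ F → ¬ lookup i l ≡ fresh F
    fresh-∉ F {i} l i∈F eq = ℕ.<-irrefl eq (ℕ.s≤s (All.lookup (xs≤max 0 (entries F))
      (∈-concatMap⁺ Vec.toList (Any.map (λ { refl → ∈-toList⁺ (∈-lookup l i) }) i∈F))))

  centralizer-vanishes : ∀ i j m → (∀ l → ¬ lookup i m ≡ lookup j l) → A i j ≈ℂ 0ℂ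
  centralizer-vanishes i j m i∉j = small⇒≈0 (A i j) λ ε 0<ε →
    let F , small-terms = hasSumℝ⇒small-terms _≟ⁱ_ {λ i → ∣ A i j ∣ℂ} {proj₁ column-sum} (proj₁ (proj₂ column-sum)) ε 0<ε
    in moved F , near F , small-terms (i′ F) (i′∉ F)
    where
    column-sum : ∃[ s ] HasSumℝ (λ i → ∣ A i j ∣ℂ) s × s ≤ℝ proj₁ (proj₁ central)
    column-sum = proj₂ (proj₁ central) j
    module _ (F : List (Index k)) where
      w : ℕ
      -- Including `j` makes the transposition fix `j`; including `F` puts the moved index outside
      -- `F`.
      w = fresh (j ∷ F)
      σ : S∞
      σ = transposition (lookup i m) w
      i′ : Index k
      i′ = Vec.map (S∞.to σ) i
      moved : ℂ
      moved = A i′ j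
      i′∉ : i′ ∉ F
      i′∉ i′∈F = fresh-∉ (j ∷ F) m (there i′∈F)
        (trans (Vec.lookup-map m (S∞.to σ) i) (swap-left (lookup i m) w))
      fixed : Vec.map (S∞.to σ) j ≡ j
      fixed = lookup-injective λ l → trans (Vec.lookup-map l (S∞.to σ) j)
        (swap-fixed (lookup i m) w (lookup j l) (i∉j l ∘ sym) (fresh-∉ (j ∷ F) l (here refl)))
      near : A i j ≈ℂ moved
      near = begin
        A i j                           ≈⟨ commute⇒equivariant σ A (proj₂ central σ) i j ⟩
        A i′ (Vec.map (S∞.to σ) j)      ≡⟨ cong (A i′) fixed ⟩
        A i′ j                          ∎
        where open ≈ℂ-Reasoning

-- The centralizer

module PartitionAlgebra (k : ℕ) where

  open FinitePartitions {Vertex k} (Sum.≡-dec _≟ᶠ_ _≟ᶠ_) (vertices k) ∈-vertices everyVertex?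
  open FormalSums ℂ-+-abelianGroup (BPDiagrams k)
  open Enumeration (selectBP partitions) (λ d → selectBP-complete d (partitions-complete (diagram d)))
  open Order {λ d e → Finer (diagram d) (diagram e)} (λ d e → finer? (diagram d) (diagram e))
    (λ {d} {e} → finer-reflexive (diagram d) (diagram e)) (λ p q x y → q x y ∘ p x y)
    (rank ∘ diagram) (λ {d} {e} → rank-mono (diagram d) (diagram e)) (λ {d} {e} → rank-strict (diagram d) (diagram e))
  open ≈ℂ-Reasoning

  fits : Index k → Index k → BPDiagram k → Bool
  fits i j d = does (fits? (diagram d) i j)

  -- A diagram goes to the 0-1 matrix whose ones are the labellings constant on its blocks. This is
  -- the analogue of `m⟨_⟩` for the 2k vertices.
  φ : BP k → Matrix k
  φ x i j = evaluate x (fits i j)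

  fits-respects : ∀ i j → Respects (fits i j)
  fits-respects i j {d} {e} d≈e = does-⇔ (mk⇔
      (fits-finer {d = diagram e} {diagram d} (finer-reflexive (diagram e) (diagram d) λ x y → sym (d≈e x y)))
      (fits-finer {d = diagram d} {diagram e} (finer-reflexive (diagram d) (diagram e) d≈e)))
    (fits? (diagram d) i j) (fits? (diagram e) i j)

  φ-cong : ∀ x y → x ≈ᴮ y → φ x ≈ᴹ φ y
  φ-cong x y x≈y i j = evaluate-cong x y {fits i j} (λ {d} {e} → fits-respects i j {d} {e}) λ d _ → x≈y d

  φ-+ : ∀ x y → φ (x +ᴮ y) ≈ᴹ (φ x +ᴹ φ y)
  φ-+ x y i j = Σ-++ x y (λ (c , d) → when (fits i j d) c)

  when-*ʳ : ∀ b c z → when b (c *ℂ z) ≈ℂ c *ℂ when b z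
  when-*ʳ true  c z = ℂ+.refl {c *ℂ z}
  when-*ʳ false c z = ℂ+.sym {c *ℂ 0ℂ} {0ℂ} (*ℂ-zeroʳ c)

  φ-• : ∀ c x → φ (c •ᴮ x) ≈ᴹ (c *ᴹ φ x)
  φ-• c []            i j = ℂ+.sym {c *ℂ 0ℂ} {0ℂ} (*ℂ-zeroʳ c)
  φ-• c ((a , d) ∷ x) i j = begin
    when b (c *ℂ a) +ℂ φ (c •ᴮ x) i j    ≈⟨ ℂ+.∙-cong {when b (c *ℂ a)} {c *ℂ when b a} {φ (c •ᴮ x) i j} {c *ℂ φ x i j}
                                              (when-*ʳ b c a) (φ-• c x i j) ⟩
    c *ℂ when b a +ℂ c *ℂ φ x i j        ≈⟨ *ℂ-distribˡ c (when b a) (φ x i j) ⟨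
    c *ℂ (when b a +ℂ φ x i j)           ∎
    where
    b = fits i j d

  φ-1 : φ 1ᴮ ≈ᴹ IdentityMatrix
  φ-1 i j = begin
    when b 1ℂ +ℂ 0ℂ                      ≈⟨ ℂ+.identityʳ (when b 1ℂ) ⟩
    when b 1ℂ                            ≡⟨ cong (λ b → when b 1ℂ) (does-⇔ (mk⇔ fits-identity⁻ fits-identity⁺) (fits? identityDiagram i j) (i ≟ⁱ j)) ⟩
    indicator i j                        ∎
    where
    b = does (fits? identityDiagram i j)

  when-* : ∀ b b′ z w → when b z *ℂ when b′ w ≈ℂ when (b ∧ b′) (z *ℂ w)
  when-* false b′    z w = *ℂ-zeroˡ (when b′ w)
  when-* true  false z w = *ℂ-zeroʳ z
  when-* true  true  z w = ℂ+.refl {z *ℂ w}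

  -- The diagram `d` forces the middle index to be `lowerIndex d l`. At that index both factors fit
  -- exactly when the stacked diagram fits the outer rows.
  product-diagrams : ∀ a d b e i l → HasFiniteSum
    (λ j → when (fits j l d) a *ℂ when (fits i j e) b) (when (fits i l (d ∗ᴮ e)) (a *ℂ b))
  product-diagrams a d b e i l = hasFiniteSum-single f j₀ {when (fits i l (d ∗ᴮ e)) (a *ℂ b)}
    (begin
      f j₀                                               ≈⟨ when-* (fits j₀ l d) (fits i j₀ e) a b ⟩
      when (fits j₀ l d ∧ fits i j₀ e) (a *ℂ b)          ≡⟨ cong (λ c → when c (a *ℂ b)) stacked ⟩
      when (fits i l (d ∗ᴮ e)) (a *ℂ b)                  ∎)
    (λ j j∉ → begin
      when (fits j l d) a *ℂ when (fits i j e) b         ≡⟨ cong (λ c → when c a *ℂ when (fits i j e) b)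
                                                              (dec-false (fits? (diagram d) j l) (j∉ ∘ here ∘ fits⇒lowerIndex d)) ⟩
      0ℂ *ℂ when (fits i j e) b                          ≈⟨ *ℂ-zeroˡ (when (fits i j e) b) ⟩
      0ℂ                                                 ∎)
    where
    j₀ : Index k
    j₀ = lowerIndex d l
    f : Index k → ℂ
    f j = when (fits j l d) a *ℂ when (fits i j e) b
    stacked : fits j₀ l d ∧ fits i j₀ e ≡ fits i l (d ∗ᴮ e)
    stacked = does-⇔ (mk⇔ (λ (p , q) → fits-∗⁺ (diagram d) (diagram e) p q)
        (λ h → fits-∗⁻ˡ d (diagram e) h , fits-∗⁻ʳ d (diagram e) h))
      (fits? (diagram d) j₀ l ×-dec fits? (diagram e) i j₀) (fits? (diagram d ∗ diagram e) i l)

  product-row : ∀ a d y i l → HasFiniteSum (λ j → when (fits j l d) a *ℂ φ y i j)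
    (φ (map (λ (b , e) → a *ℂ b , d ∗ᴮ e) y) i l)
  product-row a d []            i l = hasFiniteSum-cong {f = λ _ → 0ℂ} {λ j → when (fits j l d) a *ℂ 0ℂ} {0ℂ} {0ℂ}
    (λ j → ℂ+.sym {when (fits j l d) a *ℂ 0ℂ} {0ℂ} (*ℂ-zeroʳ (when (fits j l d) a))) (ℂ+.refl {0ℂ}) hasFiniteSum-0
  product-row a d ((b , e) ∷ y) i l = hasFiniteSum-cong
    {f = λ j → f j *ℂ g j +ℂ f j *ℂ φ y i j} {λ j → f j *ℂ (g j +ℂ φ y i j)} {s +ℂ t} {s +ℂ t}
    (λ j → ℂ+.sym {f j *ℂ (g j +ℂ φ y i j)} {f j *ℂ g j +ℂ f j *ℂ φ y i j} (*ℂ-distribˡ (f j) (g j) (φ y i j)))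
    (ℂ+.refl {s +ℂ t})
    (hasFiniteSum-+ {f = λ j → f j *ℂ g j} {λ j → f j *ℂ φ y i j} {s} {t}
      (product-diagrams a d b e i l) (product-row a d y i l))
    where
    f g : Index k → ℂ
    f j = when (fits j l d) a
    g j = when (fits i j e) b
    s t : ℂ
    s = when (fits i l (d ∗ᴮ e)) (a *ℂ b)
    t = φ (map (λ (b , e) → a *ℂ b , d ∗ᴮ e) y) i l

  product-finite : ∀ x y i l → HasFiniteSum (λ j → φ x j l *ℂ φ y i j) (φ (x *ᴮ y) i l)
  product-finite []            y i l = hasFiniteSum-cong {f = λ _ → 0ℂ} {λ j → 0ℂ *ℂ φ y i j} {0ℂ} {0ℂ}
    (λ j → ℂ+.sym {0ℂ *ℂ φ y i j} {0ℂ} (*ℂ-zeroˡ (φ y i j))) (ℂ+.refl {0ℂ}) hasFiniteSum-0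
  product-finite ((a , d) ∷ x) y i l = hasFiniteSum-cong
    {f = λ j → f j *ℂ φ y i j +ℂ φ x j l *ℂ φ y i j} {λ j → (f j +ℂ φ x j l) *ℂ φ y i j} {s +ℂ t} {φ (dy ++ x *ᴮ y) i l}
    (λ j → ℂ+.sym {(f j +ℂ φ x j l) *ℂ φ y i j} {f j *ℂ φ y i j +ℂ φ x j l *ℂ φ y i j} (*ℂ-distribʳ (φ y i j) (f j) (φ x j l)))
    (ℂ+.sym {φ (dy ++ x *ᴮ y) i l} {s +ℂ t} (φ-+ dy (x *ᴮ y) i l))
    (hasFiniteSum-+ {f = λ j → f j *ℂ φ y i j} {λ j → φ x j l *ℂ φ y i j} {s} {t}
      (product-row a d y i l) (product-finite x y i l))
    where
    f : Index k → ℂ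
    f j = when (fits j l d) a
    dy : BP k
    dy = map (λ (b , e) → a *ℂ b , d ∗ᴮ e) y
    s t : ℂ
    s = φ dy i l
    t = φ (x *ᴮ y) i l

  φ-* : ∀ x y → IsProduct (φ x) (φ y) (φ (x *ᴮ y))
  φ-* x y i l = hasFiniteSum⇒hasSum {f = λ j → φ x j l *ℂ φ y i j} {φ (x *ᴮ y) i l} (product-finite x y i l)

  φ-equivariant : ∀ x σ i j → φ x i j ≈ℂ φ x (Vec.map (S∞.to σ) i) (Vec.map (S∞.to σ) j)
  φ-equivariant x σ i j = evaluate-≗ x {fits i j} {fits (Vec.map (S∞.to σ) i) (Vec.map (S∞.to σ) j)} λ d → does-⇔
    (mk⇔ (fits-map {d = diagram d} (S∞.to σ)) (λ h u v p → to-injective σ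
      (trans (sym (labels-map (S∞.to σ) i j u)) (trans (h u v p) (labels-map (S∞.to σ) i j v)))))
    (fits? (diagram d) i j) (fits? (diagram d) (Vec.map (S∞.to σ) i) (Vec.map (S∞.to σ) j))

  -- Absolute column sums of `φ x`

  norm₁ : BP k → ℝ
  norm₁ x = Σℝ x (λ (c , _) → absℝ (re c) +ℝ absℝ (im c))

  norm₁-nonNeg : ∀ x n → 0ℚ ℚ.≤ seq (norm₁ x) n
  norm₁-nonNeg []            n = ℚ.≤-refl
  norm₁-nonNeg ((c , _) ∷ x) n = ℚ.+-mono-≤
    (ℚ.+-mono-≤ (ℚ.0≤∣p∣ (seq (re c) n)) (ℚ.0≤∣p∣ (seq (im c) n))) (norm₁-nonNeg x n)

  evaluate-bounded : ∀ x P n →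
    ℚ.∣ seq (re (evaluate x P)) n ∣ ℚ.+ ℚ.∣ seq (im (evaluate x P)) n ∣ ℚ.≤ seq (norm₁ x) n
  evaluate-bounded []            P n = ℚ.≤-refl
  evaluate-bounded ((c , d) ∷ x) P n = ℚ.≤-trans
    (∣∣₁-triangle (seq (re (when (P d) c)) n) (seq (re (evaluate x P)) n) (seq (im (when (P d) c)) n) (seq (im (evaluate x P)) n))
    (ℚ.+-mono-≤ (term (P d)) (evaluate-bounded x P n))
    where
    term : ∀ b → ℚ.∣ seq (re (when b c)) n ∣ ℚ.+ ℚ.∣ seq (im (when b c)) n ∣ ℚ.≤ ℚ.∣ seq (re c) n ∣ ℚ.+ ℚ.∣ seq (im c) n ∣
    term true  = ℚ.≤-refl
    term false = ℚ.+-mono-≤ (ℚ.0≤∣p∣ (seq (re c) n)) (ℚ.0≤∣p∣ (seq (im c) n))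

  φ-vanishes : ∀ x i j → (∀ d → ¬ Fits (diagram d) i j) → φ x i j ≈ℂ 0ℂ
  φ-vanishes x i j h = Σ-ε x {λ (c , d) → when (fits i j d) c} λ (c , d) _ → ≡⇒≈ℂ (when (fits i j d) c) 0ℂ
    (cong (λ b → when b c) (dec-false (fits? (diagram d) i j) (h d)))

  module _ (x : BP k) where

    -- Each term of `x` contributes at most one nonzero position to column `j`. Repetitions are
    -- removed because `HasSumℝ` compares lists without repetitions.
    columnSupport : Index k → List (Index k)
    columnSupport j = deduplicate _≟ⁱ_ (map (λ (_ , d) → lowerIndex d j) x)

    φ-support : ∀ i j → i ∉ columnSupport j → φ x i j ≈ℂ 0ℂ
    φ-support i j i∉ = Σ-ε x {λ (c , d) → when (fits i j d) c} λ (c , d) cd∈x → ≡⇒≈ℂ (when (fits i j d) c) 0ℂ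
      (cong (λ b → when b c) (dec-false (fits? (diagram d) i j) λ fit → i∉ (∈-deduplicate⁺ _≟ⁱ_
        (subst (_∈ map (λ (_ , d) → lowerIndex d j) x) (sym (fits⇒lowerIndex d fit)) (∈-map⁺ (λ (_ , d) → lowerIndex d j) cd∈x)))))

    columnSum : Index k → ℝ
    columnSum j = Σℝ (columnSupport j) (λ i → ∣ φ x i j ∣ℂ)

    φ-hasSum : ∀ j → HasSumℝ (λ i → ∣ φ x i j ∣ℂ) (columnSum j)
    φ-hasSum j ε 0<ε = columnSupport j , λ G !G F⊆G →
      x≈y⇒∣x-y∣≤ε {Σℝ G (λ i → ∣ φ x i j ∣ℂ)} {columnSum j}
        (ℝΣ.Σ-⊆ (DecUnique.deduplicate-! _≟ⁱ_ (map (λ (_ , d) → lowerIndex d j) x)) !G F⊆G (λ i → ∣ φ x i j ∣ℂ)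
          λ i _ i∉ → z≈0⇒∣z∣≈0 (φ x i j) (φ-support i j i∉)) 0<ε

    -- The support of a column is no longer than the list `x`, and every entry is bounded by
    -- `norm₁ x`; the resulting bound does not depend on `j`.
    φ-bound : ∀ j → columnSum j ≤ℝ Σℝ x (λ _ → norm₁ x)
    φ-bound j ε 0<ε = 0 , λ n _ → ℚ.≤-trans
      (Σℝ-mono (λ i → ∣ φ x i j ∣ℂ) (norm₁ x) n (norm₁-nonNeg x n)
        (λ i → ℚ.≤-trans (∣∣ℂ-≤ (φ x i j) n) (evaluate-bounded x (fits i j) n)) (columnSupport j) x
        (ℕ.≤-trans (List.length-deduplicate _≟ⁱ_ (map (λ (_ , d) → lowerIndex d j) x)) (ℕ.≤-reflexive (List.length-map _ x))))
      (p≤p+q {seq (Σℝ x (λ _ → norm₁ x)) n} {ε} (ℚ.<⇒≤ 0<ε))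

  φ-centralizes : ∀ x → Centralizer k (φ x)
  φ-centralizes x = (Σℝ x (λ _ → norm₁ x) , λ j → columnSum x j , φ-hasSum x j , φ-bound x j)
    , λ σ → equivariant⇒commute σ (φ x) (φ-equivariant x σ)

  -- Injectivity and surjectivity of `φ`

  lowerLabels upperLabels : Diagram k → Index k
  lowerLabels d = tabulate (label d ∘ inj₂)
  upperLabels d = tabulate (label d ∘ inj₁)

  labels-label : ∀ d u → labels (lowerLabels d) (upperLabels d) u ≡ label d u
  labels-label d (top l)    = Vec.lookup∘tabulate (label d ∘ inj₁) l
  labels-label d (bottom l) = Vec.lookup∘tabulate (label d ∘ inj₂) l

  -- The kernel of the canonical labelling of `d` is `d` itself, so the diagrams fitting it are
  -- those finer than `d`. Both injectivity and surjectivity thereby reduce to inverting the zeta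
  -- transform.
  φ≈sumBelow : ∀ x d → φ x (lowerLabels (diagram d)) (upperLabels (diagram d)) ≈ℂ sumBelow x d
  φ≈sumBelow x d = evaluate-≗ x {fits i j} {λ e → does (finer? (diagram e) δ)} λ e → does-⇔ (mk⇔
      (λ h u v p → label-∼ δ (trans (sym (labels-label δ u)) (trans (h u v p) (labels-label δ v))))
      (λ h u v p → trans (labels-label δ u) (trans (label-≡ δ (h u v p)) (sym (labels-label δ v)))))
    (fits? (diagram e) i j) (finer? (diagram e) δ)
    where
    δ = diagram d
    i = lowerLabels δ
    j = upperLabels δ

  φ-injective : ∀ x y → φ x ≈ᴹ φ y → x ≈ᴮ y
  φ-injective x y h = sumBelow-injective x y λ d → begin
    sumBelow x d                                                ≈⟨ φ≈sumBelow x d ⟨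
    φ x (lowerLabels (diagram d)) (upperLabels (diagram d))     ≈⟨ h (lowerLabels (diagram d)) (upperLabels (diagram d)) ⟩
    φ y (lowerLabels (diagram d)) (upperLabels (diagram d))     ≈⟨ φ≈sumBelow y d ⟩
    sumBelow y d                                                ∎

  labels-in-orbit : ∀ i j → let d = kernel (labels i j) in
    ∃[ σ ] Vec.map (S∞.to σ) i ≡ lowerLabels d × Vec.map (S∞.to σ) j ≡ upperLabels d
  labels-in-orbit i j = proj₁ extension
    , lookup-injective (λ l → trans (Vec.lookup-map l (S∞.to σ) i)
        (trans (proj₂ extension (bottom l) (∈-vertices {k} (bottom l))) (sym (labels-label d (bottom l)))))
    , lookup-injective (λ l → trans (Vec.lookup-map l (S∞.to σ) j)
        (trans (proj₂ extension (top l) (∈-vertices {k} (top l))) (sym (labels-label d (top l)))))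
    where
    d : Diagram k
    d = kernel (labels i j)
    extension : ∃[ σ ] ∀ u → u ∈ vertices k → S∞.to σ (labels i j u) ≡ label d u
    extension = permutation-extending (labels i j) (label d)
      (λ u v eq → label-≡ d {u} {v} (T-does⁺ (labels i j u ℕ.≟ labels i j v) eq))
      (λ u v eq → T-does⁻ (labels i j u ℕ.≟ labels i j v) (label-∼ d {u} {v} eq)) (vertices k)
    σ : S∞
    σ = proj₁ extension

  ¬bottomPropagating⇒isolated : ∀ i j → ¬ BottomPropagating (kernel (labels i j)) →
    ∃[ m ] ∀ l → ¬ lookup i m ≡ lookup j l
  ¬bottomPropagating⇒isolated i j ¬bp with all? (λ m → any? (λ l → lookup i m ℕ.≟ lookup j l))
  ... | yes partner = ⊥-elim (¬bp λ
    { (top l)    h → h (top l) (T-does⁺ (lookup j l ℕ.≟ lookup j l) refl)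
    ; (bottom m) h → h (top (proj₁ (partner m))) (T-does⁺ (lookup i m ℕ.≟ lookup j (proj₁ (partner m))) (proj₂ (partner m)))
    })
  ... | no ¬partner with ¬∀⟶∃¬ k _ (λ m → any? (λ l → lookup i m ℕ.≟ lookup j l)) ¬partner
  ...   | m , none = m , λ l eq → none (l , eq)

  module _ (A : Matrix k) (central : Centralizer k A) where

    private
      value : BPDiagram k → ℂ
      value d = A (lowerLabels (diagram d)) (upperLabels (diagram d))

      value-cong : ∀ {d e} → SamePartition (diagram d) (diagram e) → value d ≈ℂ value e
      value-cong {d} {e} d≈e = ≡⇒≈ℂ (value d) (value e) (cong₂ A
        (Vec.tabulate-cong λ l → label-cong (diagram d) (diagram e) d≈e (bottom l))
        (Vec.tabulate-cong λ l → label-cong (diagram d) (diagram e) d≈e (top l)))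

      solution : ∃[ x ] ∀ d → sumBelow x d ≈ℂ value d
      solution = sumBelow-surjective value (λ {d} {e} → value-cong {d} {e}) (rank-bounded ∘ diagram)

      preimage : BP k
      preimage = proj₁ solution

      matches : ∀ i j → Dec (BottomPropagating (kernel (labels i j))) → φ preimage i j ≈ℂ A i j
      -- Both matrices are equivariant, so the entry can be moved to the canonical labelling of the
      -- kernel, where `preimage` was made to agree with `A`.
      matches i j (yes bp) = begin
        φ preimage i j            ≈⟨ φ-equivariant preimage σ i j ⟩
        φ preimage i′ j′          ≡⟨ cong₂ (φ preimage) i′≡ j′≡ ⟩
        φ preimage (lowerLabels (diagram d)) (upperLabels (diagram d)) ≈⟨ φ≈sumBelow preimage d ⟩
        sumBelow preimage d       ≈⟨ proj₂ solution d ⟩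
        value d                   ≡⟨ cong₂ A i′≡ j′≡ ⟨
        A i′ j′                   ≈⟨ commute⇒equivariant σ A (proj₂ central σ) i j ⟨
        A i j                     ∎
        where
        d : BPDiagram k
        d = record { diagram = kernel (labels i j) ; bottomPropagating = bp }
        σ : S∞
        σ = proj₁ (labels-in-orbit i j)
        i′ j′ : Index k
        i′ = Vec.map (S∞.to σ) i
        j′ = Vec.map (S∞.to σ) j
        i′≡ : i′ ≡ lowerLabels (diagram d)
        i′≡ = proj₁ (proj₂ (labels-in-orbit i j))
        j′≡ : j′ ≡ upperLabels (diagram d)
        j′≡ = proj₂ (proj₂ (labels-in-orbit i j))
      -- Both entries vanish: a fitting bottom-propagating diagram would be finer than the kernel
      -- and make it bottom-propagating too, while for `A` the isolated bottom label forces zero.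
      matches i j (no ¬bp) = begin
        φ preimage i j            ≈⟨ φ-vanishes preimage i j (λ d fit → ¬bp (bottomPropagating-coarser
                                       {d = diagram d} {kernel (labels i j)} (constantOn⇒finer (diagram d) (labels i j) fit) (bottomPropagating d))) ⟩
        0ℂ                        ≈⟨ centralizer-vanishes central i j (proj₁ isolated) (proj₂ isolated) ⟨
        A i j                     ∎
        where
        isolated : ∃[ m ] ∀ l → ¬ lookup i m ≡ lookup j l
        isolated = ¬bottomPropagating⇒isolated i j ¬bp

    φ-surjective : ∃[ x ] φ x ≈ᴹ A
    φ-surjective = preimage , λ i j → matches i j (bottomPropagating? (kernel (labels i j)))

  isCentralizerIso : IsCentralizerIso k φ
  isCentralizerIso = record
    { φ-centralizes = φ-centralizes
    ; φ-cong        = φ-cong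
    ; φ-+           = φ-+
    ; φ-•           = φ-•
    ; φ-*           = φ-*
    ; φ-1           = φ-1
    ; φ-injective   = φ-injective
    ; φ-surjective  = φ-surjective
    }

  -- Finite dimension of the partition algebra

  coefficient-concatMap : ∀ {n} (c : Fin n → ℂ) (b : Fin n → BPDiagram k) d ls →
    coeff (concatMap (λ l → c l •ᴮ ((1ℂ , b l) ∷ [])) ls) d ≈ℂ Σ ls (λ l → when (does (DecSetoid._≟_ (BPDiagrams k) (b l) d)) (c l))
  coefficient-concatMap c b d []       = ℂ+.refl {0ℂ}
  coefficient-concatMap c b d (l ∷ ls) = ℂ+.∙-cong
    {when t (c l *ℂ 1ℂ)} {when t (c l)}
    {coeff (concatMap (λ l → c l •ᴮ ((1ℂ , b l) ∷ [])) ls) d} {Σ ls (λ l → when (does (DecSetoid._≟_ (BPDiagrams k) (b l) d)) (c l))}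
    (when-cong {t} {t} {c l *ℂ 1ℂ} {c l} refl (λ _ → *ℂ-identityʳ (c l))) (coefficient-concatMap c b d ls)
    where
    t = does (DecSetoid._≟_ (BPDiagrams k) (b l) d)

  finiteDimensional : BP-FiniteDimensional k
  -- The spanning family consists of single diagrams, one for each class, and the coordinates of `x`
  -- are its coefficients there.
  finiteDimensional = length elements , (λ l → (1ℂ , List.lookup elements l) ∷ []) , λ x → c x , λ d → begin
    coeff x d                                                    ≈⟨ evaluate-expand x {δ d} (λ {a} {b} → δ-respects d {a} {b}) ⟩
    Σ elements (term x d)                                        ≡⟨ cong (λ E → Σ E (term x d)) elements≡ ⟨
    Σ (map (List.lookup elements) (allFin (length elements))) (term x d)
      ≈⟨ Σ-map (List.lookup elements) (allFin (length elements)) (term x d) ⟩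
    Σ (allFin (length elements)) (term x d ∘ List.lookup elements)
      ≈⟨ coefficient-concatMap (c x) (List.lookup elements) d (allFin (length elements)) ⟨
    coeff (concatMap (λ l → c x l •ᴮ ((1ℂ , List.lookup elements l) ∷ [])) (allFin (length elements))) d ∎
    where
    open DecSetoid (BPDiagrams k) using (_≟_) renaming (_≈_ to _≋_; sym to ≋-sym; trans to ≋-trans)
    c : BP k → Fin (length elements) → ℂ
    c x l = coeff x (List.lookup elements l)
    δ : BPDiagram k → BPDiagram k → Bool
    δ d e = does (e ≟ d)
    term : BP k → BPDiagram k → BPDiagram k → ℂ
    term x d e = when (δ d e) (coeff x e)
    δ-respects : ∀ d → Respects (δ d)
    δ-respects d {a} {b} a≈b = does-⇔ (mk⇔ (≋-trans {b} {a} {d} (≋-sym {a} {b} a≈b)) (≋-trans {a} {b} {d} a≈b)) (a ≟ d) (b ≟ d)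
    elements≡ : map (List.lookup elements) (allFin (length elements)) ≡ elements
    elements≡ = trans (List.map-tabulate (λ l → l) (List.lookup elements)) (List.tabulate-lookup elements)

theorem8 : (k : ℕ) → 1 ≤ k →
    IsBasis (ℓ∞-Invariants k) (Partitions k) m⟨_⟩
    × BP-FiniteDimensional k
    × (∃[ φ ] IsCentralizerIso k φ)
theorem8 k _ = Invariants.isBasis k , PartitionAlgebra.finiteDimensional k
  , PartitionAlgebra.φ k , PartitionAlgebra.isCentralizerIso k
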